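{- Let $n\geq1$, $r=2^n$ and $M=6^{2^n}+1$. Let $\pi=2+3\zeta_3\in\mathbb{Z}[\zeta_6]$ and $\alpha=\pi/\bar\pi$. Define the sequence $\{S_k\}_{k\ge 0}$ by $S_0=\alpha+\bar\alpha$ and $S_{k+1}=S_k^6-6S_k^4+9S_k^2-2$ for $k\geq0$. Then $M$ is prime if and only if $S_{r-1}\equiv-1\pmod M$.
   Context: $\zeta_m=e^{2\pi\sqrt{ -1}/m}$ and a bar denotes complex conjugation. The $S_k$ are rational numbers with denominators prime to $M$; the congruence modulo $M$ is understood in the ring of rationals with denominator prime to $M$. -}

module Defs where

open import Data.Integer using (+_)
open import Data.Nat as ℕ using (ℕ; zero; suc)
open import Data.Nat.Coprimality using (Coprime)
open import Data.Product using (_×_; ∃-syntax)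
open import Data.Rational
open import Data.Rational.Literals using (fromℤ)
open import Relation.Binary.PropositionalEquality using (_≡_; refl)
open import Algebra.Definitions.RawSemiring +-*-rawSemiring public using (_^_)

fromℕ : ℕ → ℚ
fromℕ n = fromℤ (+ n)

-- The field ℚ(ζ₆) = ℚ[x]/(x² - x + 1): the pair ⟨ a , b ⟩ is a + b ζ₆.
-- Its elements with integer coordinates form ℤ[ζ₆].
record ℚ[ζ₆] : Set where
  constructor ⟨_,_⟩
  field
    fst snd : ℚ

open ℚ[ζ₆] public

infixl 7 _*ᴷ_ _÷ᴷ_
infixl 6 _+ᴷ_

ι : ℚ → ℚ[ζ₆]
ι a = ⟨ a , 0ℚ ⟩

ζ₆ : ℚ[ζ₆]
ζ₆ = ⟨ 0ℚ , 1ℚ ⟩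

_+ᴷ_ : ℚ[ζ₆] → ℚ[ζ₆] → ℚ[ζ₆]
⟨ a , b ⟩ +ᴷ ⟨ c , d ⟩ = ⟨ a + c , b + d ⟩

-- ζ₆² = ζ₆ - 1
_*ᴷ_ : ℚ[ζ₆] → ℚ[ζ₆] → ℚ[ζ₆]
⟨ a , b ⟩ *ᴷ ⟨ c , d ⟩ = ⟨ a * c - b * d , a * d + b * c + b * d ⟩

-- Complex conjugation: the conjugate of ζ₆ is ζ₆⁻¹ = 1 - ζ₆.
conj : ℚ[ζ₆] → ℚ[ζ₆]
conj ⟨ a , b ⟩ = ⟨ a + b , - b ⟩

-- norm z is the rational number z *ᴷ conj z.
norm : ℚ[ζ₆] → ℚ
norm ⟨ a , b ⟩ = a * a + a * b + b * b

_÷ᴷ_ : (z w : ℚ[ζ₆]) → .{{_ : NonZero (norm w)}} → ℚ[ζ₆]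
z ÷ᴷ w = z *ᴷ conj w *ᴷ ι (1/ norm w)

ζ₃ : ℚ[ζ₆]
ζ₃ = ζ₆ *ᴷ ζ₆

π : ℚ[ζ₆]
π = ι (fromℕ 2) +ᴷ ι (fromℕ 3) *ᴷ ζ₃

α : ℚ[ζ₆]
α = π ÷ᴷ conj π

-- α + conj α is rational (see ι-S₀), so it is equal to its first coordinate.
S₀ : ℚ
S₀ = fst (α +ᴷ conj α)

ι-S₀ : ι S₀ ≡ α +ᴷ conj α
ι-S₀ = refl

S : ℕ → ℚ
S zero    = S₀
S (suc k) = S k ^ 6 - fromℕ 6 * S k ^ 4 + fromℕ 9 * S k ^ 2 - fromℕ 2

-- Membership in the ring of rationals with denominator prime to M.
DenominatorPrimeTo : ℕ → ℚ → Set
DenominatorPrimeTo M q = Coprime (↧ₙ q) M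

-- Congruence modulo the ideal generated by M in that ring.  If one of x, y
-- lies in the ring, x ≈ y [mod M ] forces the other to lie in it as well.
infix 4 _≈_[mod_]
_≈_[mod_] : ℚ → ℚ → ℕ → Set
x ≈ y [mod M ] = ∃[ c ] (DenominatorPrimeTo M c × x - y ≡ fromℕ M * c)

module Submission where

-- Write r = k + 1, K = 6ᵏ, so that M = 6K + 1, and let X = πᴷ, Y = π̄ᴷ in ℤ[ζ₆].  Since S_k is
-- αᴷ + ᾱᴷ and ππ̄ = 7, S_k + 1 = (X² + XY + Y²) / 7ᴷ, so S_k ≡ -1 (mod M) says that αᴷ = X/Y is a
-- primitive cube root of unity mod M.
-- If M is prime, let g be the Gauss sum of the sextic character mod 7, an element of ℤ[ζ₄₂].
-- Then g⁶ = -ππ̄⁵, while the Frobenius map and M ≡ 2 (mod 7) give gᴹ ≡ ζ₆⁴ g.  Comparing the two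
-- through gᴹ = (g⁶)ᴷ g, and using π̄⁶ᴷ = π̄ᴹ⁻¹ ≡ 1, yields X ≡ ζ₆⁴ Y.
-- Conversely, let q be a prime divisor of M.  The Frobenius map of ℤ[ζ₆]/q fixes π and π̄ or swaps
-- them, so α has order dividing q - 1 or q + 1 there.  Since αᴷ has order 3 and K = 2ᵏ3ᵏ, the power
-- 3ʳ divides that order, so q ≥ 3ʳ - 1.  As (3ʳ - 1)² > M, M is prime.

open import Defs using (S; _≈_[mod_]; fromℕ; DenominatorPrimeTo) renaming (_^_ to _^ℚ_)

open import Algebra.Bundles using (CommutativeRing; AbelianGroup)
import Algebra.Consequences.Setoid as Consequences
open import Algebra.Construct.DirectProduct using (abelianGroup)
open import Algebra.Core using (Op₂)
import Algebra.Definitions as Laws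
import Algebra.Properties.CommutativeSemiring.Binomial as Binomial
import Algebra.Properties.CommutativeSemiring.Exp as CommutativeExp
import Algebra.Properties.Ring as RingProperties
import Algebra.Properties.Semiring.Exp as Exp
import Algebra.Properties.Semiring.Mult as Mult
import Algebra.Properties.Semiring.Sum as Sum
import Algebra.Solver.Ring.NaturalCoefficients.Default as SemiringSolver
open import Data.Fin.Base as Fin using (zero; suc; inject₁)
open import Data.Fin.Patterns using (0F; 1F; 2F; 3F; 4F; 5F)
open import Data.Fin.Properties using (toℕ-inject₁; toℕ<n; toℕ-fromℕ)
open import Data.Integer as ℤ using (ℤ; +_; 0ℤ; 1ℤ; -1ℤ)
import Data.Integer.Divisibility.Signed as ℤ
import Data.Integer.Properties as ℤ
import Data.Integer.Tactic.RingSolver as ℤ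
open import Data.Nat as ℕ using (ℕ; zero; suc; z≤n; s≤s)
open import Data.Nat.Combinatorics using (_C_; nC1≡n; nCn≡1; nCk+nC[k+1]≡[n+1]C[k+1])
open import Data.Nat.Coprimality as Coprimality using (Coprime; coprime-divisor)
open import Data.Nat.Divisibility as ℕ using (divides)
open import Data.Nat.DivMod using (DivMod; _divMod_; result)
open import Data.Nat.Primality
  using (Prime; ¬prime[0]; ¬prime[1]; euclidsLemma; _Rough_; 0-rough; 1-rough; 2-rough;
         ∤⇒rough-suc; rough∧∣⇒prime; rough∧square>⇒prime)
import Data.Nat.Properties as ℕ
import Data.Nat.Tactic.RingSolver as ℕ
open import Data.Product using (_×_; _,_; proj₁; proj₂; ∃-syntax)
open import Data.Rational as ℚ using (ℚ; 1ℚ; ↥_; ↧_; ↧ₙ_; mkℚ)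
open import Data.Rational.Literals using (fromℤ)
import Data.Rational.Properties as ℚ
open import Data.Rational.Solver using (module +-*-Solver)
import Data.Rational.Unnormalised as ℚᵘ
import Data.Rational.Unnormalised.Properties as ℚᵘ
open import Data.Sum using (inj₁; inj₂)
open import Function.Bundles using (_⇔_; mk⇔)
open import Level using (Level; 0ℓ; _⊔_)
open import Relation.Binary.PropositionalEquality as ≡ using (_≡_)
open import Relation.Nullary using (¬_; contradiction)

private variable
  ℓ₁ ℓ₂ : Level
  A     : Set ℓ₁

-- Ring extensions

module _ (G : AbelianGroup ℓ₁ ℓ₂) where

  open AbelianGroup G
  open Laws _≈_
  open Consequences setoid

  -- Both kinds of extension and the residue rings of ℤ are built through this; commutativity
  -- supplies the right-hand laws.
  commutativeRing : (_*_ : Op₂ Carrier) (1# : Carrier) →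
    Congruent₂ _*_ → Associative _*_ → Commutative _*_ →
    LeftIdentity 1# _*_ → _*_ DistributesOverˡ _∙_ → CommutativeRing ℓ₁ ℓ₂
  commutativeRing _*_ 1# *-cong *-assoc *-comm *-identityˡ distribˡ = record
    { _*_ = _*_
    ; 1# = 1#
    ; isCommutativeRing = record
      { isRing = record
        { +-isAbelianGroup = isAbelianGroup
        ; *-cong = *-cong
        ; *-assoc = *-assoc
        ; *-identity = comm∧idˡ⇒id *-comm *-identityˡ
        ; distrib = comm∧distrˡ⇒distr ∙-cong *-comm distribˡ
        }
      ; *-comm = *-comm
      }
    }

-- A form of "the characteristic divides n" that passes to an extension coordinate by coordinate.
-- The Frobenius map relies on it.
Annihilates : ℕ → CommutativeRing ℓ₁ ℓ₂ → Set (ℓ₁ ⊔ ℓ₂)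
Annihilates n R = ∀ x → n · x ≈ 0#
  where
  open CommutativeRing R
  open Mult semiring using () renaming (_×_ to _·_)

-- The products are stated over bare operations, so that they apply to the expressions of the
-- ring solver as well as to ring elements.
quadraticProduct : (_+_ _*_ : Op₂ A) (a b : A) → Op₂ (A × A)
quadraticProduct _+_ _*_ a b (x₀ , x₁) (y₀ , y₁) =
  (x₀ * y₀) + ((x₁ * y₁) * b) ,
  ((x₀ * y₁) + (x₁ * y₀)) + ((x₁ * y₁) * a)

cubicProduct : (_+_ _*_ : Op₂ A) (a b d : A) → Op₂ (A × A × A)
cubicProduct _+_ _*_ a b d (x₀ , x₁ , x₂) (y₀ , y₁ , y₂) =
  -- The overflow coefficients z₃ and z₄ are reduced by x³ = ax² + bx + d and x⁴ = (a² + b)x² + (ab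
  -- + d)x + ad.
  (z₀ + (z₃ * d)) + (z₄ * (a * d)) ,
  (z₁ + (z₃ * b)) + (z₄ * ((a * b) + d)) ,
  (z₂ + (z₃ * a)) + (z₄ * ((a * a) + b))
  where
  z₀ = x₀ * y₀
  z₁ = (x₀ * y₁) + (x₁ * y₀)
  z₂ = ((x₀ * y₂) + (x₁ * y₁)) + (x₂ * y₀)
  z₃ = (x₁ * y₂) + (x₂ * y₁)
  z₄ = x₂ * y₂

-- R[x]/(x² - ax - b)
module QuadraticExtension (R : CommutativeRing ℓ₁ ℓ₂) (a b : CommutativeRing.Carrier R) where

  open CommutativeRing R hiding (zero)
  open SemiringSolver commutativeSemiring

  private
    _⊛_ : Op₂ (Carrier × Carrier)
    _⊛_ = quadraticProduct _+_ _*_ a b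

    additiveGroup : AbelianGroup ℓ₁ ℓ₂
    additiveGroup = abelianGroup +-abelianGroup +-abelianGroup

    open AbelianGroup additiveGroup using (_∙_) renaming (_≈_ to _≋_)
    open Laws _≋_

    ⊛-cong : Congruent₂ _⊛_
    ⊛-cong (p₀ , p₁) (q₀ , q₁) =
      +-cong (*-cong p₀ q₀) (*-congʳ (*-cong p₁ q₁)) ,
      +-cong (+-cong (*-cong p₀ q₁) (*-cong p₁ q₀)) (*-congʳ (*-cong p₁ q₁))

    ⊛-assoc : Associative _⊛_
    ⊛-assoc (x₀ , x₁) (y₀ , y₁) (z₀ , z₁) =
      solve 8 (λ a b x₀ x₁ y₀ y₁ z₀ z₁ →
        let x = x₀ , x₁ ; y = y₀ , y₁ ; z = z₀ , z₁ ; _⊛_ = quadraticProduct _:+_ _:*_ a b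
        in proj₁ ((x ⊛ y) ⊛ z) := proj₁ (x ⊛ (y ⊛ z)))
        refl a b x₀ x₁ y₀ y₁ z₀ z₁ ,
      solve 8 (λ a b x₀ x₁ y₀ y₁ z₀ z₁ →
        let x = x₀ , x₁ ; y = y₀ , y₁ ; z = z₀ , z₁ ; _⊛_ = quadraticProduct _:+_ _:*_ a b
        in proj₂ ((x ⊛ y) ⊛ z) := proj₂ (x ⊛ (y ⊛ z)))
        refl a b x₀ x₁ y₀ y₁ z₀ z₁

    ⊛-comm : Commutative _⊛_
    ⊛-comm (x₀ , x₁) (y₀ , y₁) =
      +-cong (*-comm x₀ y₀) (*-congʳ (*-comm x₁ y₁)) ,
      +-cong (trans (+-comm _ _) (+-cong (*-comm x₁ y₀) (*-comm x₀ y₁))) (*-congʳ (*-comm x₁ y₁))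

    ⊛-identityˡ : LeftIdentity (1# , 0#) _⊛_
    ⊛-identityˡ (x₀ , x₁) =
      solve 3 (λ b x₀ x₁ → con 1 :* x₀ :+ con 0 :* x₁ :* b := x₀) refl b x₀ x₁ ,
      solve 3 (λ a x₀ x₁ → con 1 :* x₁ :+ con 0 :* x₀ :+ con 0 :* x₁ :* a := x₁) refl a x₀ x₁

    ⊛-distribˡ : _⊛_ DistributesOverˡ _∙_
    ⊛-distribˡ (x₀ , x₁) (y₀ , y₁) (z₀ , z₁) =
      solve 7 (λ b x₀ x₁ y₀ y₁ z₀ z₁ →
        x₀ :* (y₀ :+ z₀) :+ x₁ :* (y₁ :+ z₁) :* b :=
        x₀ :* y₀ :+ x₁ :* y₁ :* b :+ (x₀ :* z₀ :+ x₁ :* z₁ :* b))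
        refl b x₀ x₁ y₀ y₁ z₀ z₁ ,
      solve 7 (λ a x₀ x₁ y₀ y₁ z₀ z₁ →
        x₀ :* (y₁ :+ z₁) :+ x₁ :* (y₀ :+ z₀) :+ x₁ :* (y₁ :+ z₁) :* a :=
        x₀ :* y₁ :+ x₁ :* y₀ :+ x₁ :* y₁ :* a :+ (x₀ :* z₁ :+ x₁ :* z₀ :+ x₁ :* z₁ :* a))
        refl a x₀ x₁ y₀ y₁ z₀ z₁

  extension : CommutativeRing ℓ₁ ℓ₂
  extension = commutativeRing additiveGroup _⊛_ (1# , 0#)
    ⊛-cong ⊛-assoc ⊛-comm ⊛-identityˡ ⊛-distribˡ

  private module E = CommutativeRing extension

  ι : Carrier → E.Carrier
  ι x = x , 0#

  ι-* : ∀ x y → ι (x * y) E.≈ ι x E.* ι y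
  ι-* x y =
    solve 3 (λ x y b → x :* y := x :* y :+ con 0 :* con 0 :* b) refl x y b ,
    solve 3 (λ x y a → con 0 := x :* con 0 :+ con 0 :* y :+ con 0 :* con 0 :* a) refl x y a

  ι-+ : ∀ x y → ι (x + y) E.≈ ι x E.+ ι y
  ι-+ x y = refl , sym (+-identityʳ 0#)

  annihilates : ∀ {n} → Annihilates n R → Annihilates n extension
  annihilates {n} n·≈0 (x₀ , x₁) =
    E.trans (E.reflexive (componentwise n)) (n·≈0 x₀ , n·≈0 x₁)
    where
    open Mult semiring using () renaming (_×_ to _·_)
    open Mult E.semiring using () renaming (_×_ to _·ᴱ_)
    componentwise : ∀ n → n ·ᴱ (x₀ , x₁) ≡ (n · x₀ , n · x₁)
    componentwise zero    = ≡.refl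
    componentwise (suc n) = ≡.cong ((x₀ , x₁) E.+_) (componentwise n)

-- R[x]/(x³ - ax² - bx - d)
module CubicExtension (R : CommutativeRing ℓ₁ ℓ₂) (a b d : CommutativeRing.Carrier R) where

  open CommutativeRing R hiding (zero)
  open SemiringSolver commutativeSemiring

  private
    _⊛_ : Op₂ (Carrier × Carrier × Carrier)
    _⊛_ = cubicProduct _+_ _*_ a b d

    additiveGroup : AbelianGroup ℓ₁ ℓ₂
    additiveGroup = abelianGroup +-abelianGroup (abelianGroup +-abelianGroup +-abelianGroup)

    open AbelianGroup additiveGroup using (_∙_) renaming (_≈_ to _≋_)
    open Laws _≋_

    ⊛-cong : Congruent₂ _⊛_
    ⊛-cong (p₀ , p₁ , p₂) (q₀ , q₁ , q₂) =
      +-cong (+-cong e₀ (*-congʳ e₃)) (*-congʳ e₄) ,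
      +-cong (+-cong e₁ (*-congʳ e₃)) (*-congʳ e₄) ,
      +-cong (+-cong e₂ (*-congʳ e₃)) (*-congʳ e₄)
      where
      e₀ = *-cong p₀ q₀
      e₁ = +-cong (*-cong p₀ q₁) (*-cong p₁ q₀)
      e₂ = +-cong (+-cong (*-cong p₀ q₂) (*-cong p₁ q₁)) (*-cong p₂ q₀)
      e₃ = +-cong (*-cong p₁ q₂) (*-cong p₂ q₁)
      e₄ = *-cong p₂ q₂

    ⊛-assoc : Associative _⊛_
    ⊛-assoc (x₀ , x₁ , x₂) (y₀ , y₁ , y₂) (z₀ , z₁ , z₂) =
      solve 12 (λ a b d x₀ x₁ x₂ y₀ y₁ y₂ z₀ z₁ z₂ →
        let x = x₀ , x₁ , x₂ ; y = y₀ , y₁ , y₂ ; z = z₀ , z₁ , z₂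
            _⊛_ = cubicProduct _:+_ _:*_ a b d
        in proj₁ ((x ⊛ y) ⊛ z) := proj₁ (x ⊛ (y ⊛ z)))
        refl a b d x₀ x₁ x₂ y₀ y₁ y₂ z₀ z₁ z₂ ,
      solve 12 (λ a b d x₀ x₁ x₂ y₀ y₁ y₂ z₀ z₁ z₂ →
        let x = x₀ , x₁ , x₂ ; y = y₀ , y₁ , y₂ ; z = z₀ , z₁ , z₂
            _⊛_ = cubicProduct _:+_ _:*_ a b d
        in proj₁ (proj₂ ((x ⊛ y) ⊛ z)) := proj₁ (proj₂ (x ⊛ (y ⊛ z))))
        refl a b d x₀ x₁ x₂ y₀ y₁ y₂ z₀ z₁ z₂ ,
      solve 12 (λ a b d x₀ x₁ x₂ y₀ y₁ y₂ z₀ z₁ z₂ →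
        let x = x₀ , x₁ , x₂ ; y = y₀ , y₁ , y₂ ; z = z₀ , z₁ , z₂
            _⊛_ = cubicProduct _:+_ _:*_ a b d
        in proj₂ (proj₂ ((x ⊛ y) ⊛ z)) := proj₂ (proj₂ (x ⊛ (y ⊛ z))))
        refl a b d x₀ x₁ x₂ y₀ y₁ y₂ z₀ z₁ z₂

    ⊛-comm : Commutative _⊛_
    ⊛-comm (x₀ , x₁ , x₂) (y₀ , y₁ , y₂) =
      +-cong (+-cong e₀ (*-congʳ e₃)) (*-congʳ e₄) ,
      +-cong (+-cong e₁ (*-congʳ e₃)) (*-congʳ e₄) ,
      +-cong (+-cong e₂ (*-congʳ e₃)) (*-congʳ e₄)
      where
      swap : ∀ {u v u′ v′} → u ≈ v′ → v ≈ u′ → u + v ≈ u′ + v′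
      swap {u} {v} p q = trans (+-comm u v) (+-cong q p)
      e₀ = *-comm x₀ y₀
      e₁ = swap (*-comm x₀ y₁) (*-comm x₁ y₀)
      e₂ = trans (+-assoc (x₀ * y₂) (x₁ * y₁) (x₂ * y₀))
             (swap (*-comm x₀ y₂) (swap (*-comm x₁ y₁) (*-comm x₂ y₀)))
      e₃ = swap (*-comm x₁ y₂) (*-comm x₂ y₁)
      e₄ = *-comm x₂ y₂

    ⊛-identityˡ : LeftIdentity (1# , 0# , 0#) _⊛_
    ⊛-identityˡ (x₀ , x₁ , x₂) =
      solve 6 (λ a b d x₀ x₁ x₂ → let _⊛_ = cubicProduct _:+_ _:*_ a b d in
        proj₁ ((con 1 , con 0 , con 0) ⊛ (x₀ , x₁ , x₂)) := x₀) refl a b d x₀ x₁ x₂ ,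
      solve 6 (λ a b d x₀ x₁ x₂ → let _⊛_ = cubicProduct _:+_ _:*_ a b d in
        proj₁ (proj₂ ((con 1 , con 0 , con 0) ⊛ (x₀ , x₁ , x₂))) := x₁) refl a b d x₀ x₁ x₂ ,
      solve 6 (λ a b d x₀ x₁ x₂ → let _⊛_ = cubicProduct _:+_ _:*_ a b d in
        proj₂ (proj₂ ((con 1 , con 0 , con 0) ⊛ (x₀ , x₁ , x₂))) := x₂) refl a b d x₀ x₁ x₂

    ⊛-distribˡ : _⊛_ DistributesOverˡ _∙_
    ⊛-distribˡ (x₀ , x₁ , x₂) (y₀ , y₁ , y₂) (z₀ , z₁ , z₂) =
      solve 12 (λ a b d x₀ x₁ x₂ y₀ y₁ y₂ z₀ z₁ z₂ →
        let x = x₀ , x₁ , x₂ ; y = y₀ , y₁ , y₂ ; z = z₀ , z₁ , z₂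
            y+z = y₀ :+ z₀ , y₁ :+ z₁ , y₂ :+ z₂
            _⊛_ = cubicProduct _:+_ _:*_ a b d
        in proj₁ (x ⊛ y+z) := proj₁ (x ⊛ y) :+ proj₁ (x ⊛ z))
        refl a b d x₀ x₁ x₂ y₀ y₁ y₂ z₀ z₁ z₂ ,
      solve 12 (λ a b d x₀ x₁ x₂ y₀ y₁ y₂ z₀ z₁ z₂ →
        let x = x₀ , x₁ , x₂ ; y = y₀ , y₁ , y₂ ; z = z₀ , z₁ , z₂
            y+z = y₀ :+ z₀ , y₁ :+ z₁ , y₂ :+ z₂
            _⊛_ = cubicProduct _:+_ _:*_ a b d
        in proj₁ (proj₂ (x ⊛ y+z)) := proj₁ (proj₂ (x ⊛ y)) :+ proj₁ (proj₂ (x ⊛ z)))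
        refl a b d x₀ x₁ x₂ y₀ y₁ y₂ z₀ z₁ z₂ ,
      solve 12 (λ a b d x₀ x₁ x₂ y₀ y₁ y₂ z₀ z₁ z₂ →
        let x = x₀ , x₁ , x₂ ; y = y₀ , y₁ , y₂ ; z = z₀ , z₁ , z₂
            y+z = y₀ :+ z₀ , y₁ :+ z₁ , y₂ :+ z₂
            _⊛_ = cubicProduct _:+_ _:*_ a b d
        in proj₂ (proj₂ (x ⊛ y+z)) := proj₂ (proj₂ (x ⊛ y)) :+ proj₂ (proj₂ (x ⊛ z)))
        refl a b d x₀ x₁ x₂ y₀ y₁ y₂ z₀ z₁ z₂

  extension : CommutativeRing ℓ₁ ℓ₂
  extension = commutativeRing additiveGroup _⊛_ (1# , 0# , 0#)
    ⊛-cong ⊛-assoc ⊛-comm ⊛-identityˡ ⊛-distribˡ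

  private module E = CommutativeRing extension

  ι : Carrier → E.Carrier
  ι x = x , 0# , 0#

  ι-* : ∀ x y → ι (x * y) E.≈ ι x E.* ι y
  ι-* x y =
    solve 5 (λ x y a b d → let _⊛_ = cubicProduct _:+_ _:*_ a b d in
      x :* y := proj₁ ((x , con 0 , con 0) ⊛ (y , con 0 , con 0))) refl x y a b d ,
    solve 5 (λ x y a b d → let _⊛_ = cubicProduct _:+_ _:*_ a b d in
      con 0 := proj₁ (proj₂ ((x , con 0 , con 0) ⊛ (y , con 0 , con 0)))) refl x y a b d ,
    solve 5 (λ x y a b d → let _⊛_ = cubicProduct _:+_ _:*_ a b d in
      con 0 := proj₂ (proj₂ ((x , con 0 , con 0) ⊛ (y , con 0 , con 0)))) refl x y a b d

  annihilates : ∀ {n} → Annihilates n R → Annihilates n extension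
  annihilates {n} n·≈0 (x₀ , x₁ , x₂) =
    E.trans (E.reflexive (componentwise n)) (n·≈0 x₀ , n·≈0 x₁ , n·≈0 x₂)
    where
    open Mult semiring using () renaming (_×_ to _·_)
    open Mult E.semiring using () renaming (_×_ to _·ᴱ_)
    componentwise : ∀ n → n ·ᴱ (x₀ , x₁ , x₂) ≡ (n · x₀ , n · x₁ , n · x₂)
    componentwise zero    = ≡.refl
    componentwise (suc n) = ≡.cong ((x₀ , x₁ , x₂) E.+_) (componentwise n)

-- The Frobenius map

-- The absorption identity, in a form free of division so that Euclid's lemma applies. Pascal's rule
-- splits the left-hand side, induction rewrites both pieces, and Pascal's rule joins them again.
[k+1]*[n+1]C[k+1]≡[n+1]*nCk : ∀ n k → suc k ℕ.* (suc n C suc k) ≡ suc n ℕ.* (n C k)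
[k+1]*[n+1]C[k+1]≡[n+1]*nCk n zero = begin
  suc n C 1 ℕ.+ 0 ≡⟨ ℕ.+-identityʳ _ ⟩
  suc n C 1       ≡⟨ nC1≡n (suc n) ⟩
  suc n           ≡⟨ ℕ.*-identityʳ (suc n) ⟨
  suc n ℕ.* 1     ∎
  where open ≡.≡-Reasoning
[k+1]*[n+1]C[k+1]≡[n+1]*nCk zero (suc k) = ℕ.*-zeroʳ k
[k+1]*[n+1]C[k+1]≡[n+1]*nCk (suc n) (suc k) = begin
  suc (suc k) ℕ.* (suc (suc n) C suc (suc k))
    ≡⟨ ≡.cong (suc (suc k) ℕ.*_) (nCk+nC[k+1]≡[n+1]C[k+1] (suc n) (suc k)) ⟨
  suc (suc k) ℕ.* (p ℕ.+ q)
    ≡⟨ split (suc k) p q ⟩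
  p ℕ.+ suc k ℕ.* p ℕ.+ suc (suc k) ℕ.* q
    ≡⟨ ≡.cong₂ (λ u v → p ℕ.+ u ℕ.+ v)
         ([k+1]*[n+1]C[k+1]≡[n+1]*nCk n k) ([k+1]*[n+1]C[k+1]≡[n+1]*nCk n (suc k)) ⟩
  p ℕ.+ suc n ℕ.* (n C k) ℕ.+ suc n ℕ.* (n C suc k)
    ≡⟨ ℕ.+-assoc p _ _ ⟩
  p ℕ.+ (suc n ℕ.* (n C k) ℕ.+ suc n ℕ.* (n C suc k))
    ≡⟨ ≡.cong (p ℕ.+_) (ℕ.*-distribˡ-+ (suc n) (n C k) (n C suc k)) ⟨
  p ℕ.+ suc n ℕ.* (n C k ℕ.+ n C suc k)
    ≡⟨ ≡.cong (λ u → p ℕ.+ suc n ℕ.* u) (nCk+nC[k+1]≡[n+1]C[k+1] n k) ⟩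
  suc (suc n) ℕ.* p ∎
  where
  open ≡.≡-Reasoning
  p = suc n C suc k
  q = suc n C suc (suc k)
  split : ∀ k p q → suc k ℕ.* (p ℕ.+ q) ≡ p ℕ.+ k ℕ.* p ℕ.+ suc k ℕ.* q
  split = ℕ.solve-∀

-- By absorption p divides k · C(p, k), and it cannot divide k, which is positive and below p.
p∣pCk : ∀ {p k} → Prime p → 0 ℕ.< k → k ℕ.< p → p ℕ.∣ p C k
p∣pCk {suc n} {suc k} p-prime _ k<p
  with euclidsLemma (suc k) (suc n C suc k) p-prime
         (≡.subst (suc n ℕ.∣_) (≡.sym ([k+1]*[n+1]C[k+1]≡[n+1]*nCk n k)) (ℕ.m∣m*n (n C k)))
... | inj₁ p∣k = contradiction (ℕ.∣⇒≤ p∣k) (ℕ.<⇒≱ k<p)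
... | inj₂ p∣C = p∣C

module Frobenius (R : CommutativeRing ℓ₁ ℓ₂) {p : ℕ} (p-prime : Prime p) (p·x≈0 : Annihilates p R) where

  open CommutativeRing R hiding (zero)
  open Exp semiring using (_^_)
  open Mult semiring using (×-congˡ; ×-assocˡ; ×-homo-1) renaming (_×_ to _·_)
  open Sum semiring using (sum; sum-init-last; sum-cong-≋; sum-replicate-zero)
  open Binomial commutativeSemiring using (binomialTerm; theorem)
  open import Relation.Binary.Reasoning.Setoid setoid

  private
    ∣⇒·≈0 : ∀ {n} x → p ℕ.∣ n → n · x ≈ 0#
    ∣⇒·≈0 x (divides q ≡.refl) =
      trans (×-congˡ {x} (ℕ.*-comm q p)) (trans (sym (×-assocˡ x p q)) (p·x≈0 (q · x)))

  -- In the binomial expansion every inner coefficient is a multiple of p, so its term vanishes and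
  -- only the two ends survive.
  ^p-+ : ∀ x y → (x + y) ^ p ≈ x ^ p + y ^ p
  ^p-+ x y = freshman p p-prime (λ {i} 0<i i<p → ∣⇒·≈0 _ (p∣pCk p-prime 0<i i<p))
    where
    -- The exponent is generalised from the module parameter `p`, because it has to be matched
    -- against `zero` and `suc`.
    freshman : ∀ q → Prime q →
      (∀ {i z} → 0 ℕ.< i → i ℕ.< q → (q C i) · z ≈ 0#) → (x + y) ^ q ≈ x ^ q + y ^ q
    freshman zero prime[0] _ = contradiction prime[0] ¬prime[0]
    freshman (suc q) _ vanishing = begin
      (x + y) ^ suc q
        ≈⟨ theorem (suc q) x y ⟩
      term zero + sum (λ i → term (suc i))
        ≈⟨ +-cong first (sum-init-last (λ i → term (suc i))) ⟩
      y ^ suc q + (sum (λ i → term (suc (inject₁ i))) + term (suc (Fin.fromℕ q)))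
        ≈⟨ +-congˡ (+-cong (trans (sum-cong-≋ middle) (sum-replicate-zero q)) last) ⟩
      y ^ suc q + (0# + x ^ suc q)
        ≈⟨ +-congˡ (+-identityˡ _) ⟩
      y ^ suc q + x ^ suc q
        ≈⟨ +-comm _ _ ⟩
      x ^ suc q + y ^ suc q ∎
      where
      term = binomialTerm x y (suc q)
      first : term zero ≈ y ^ suc q
      first = trans (×-homo-1 _) (*-identityˡ _)
      middle : ∀ i → term (suc (inject₁ i)) ≈ 0#
      middle i = vanishing (s≤s z≤n)
        (s≤s (≡.subst (ℕ._< q) (≡.sym (toℕ-inject₁ i)) (toℕ<n i)))
      last : term (suc (Fin.fromℕ q)) ≈ x ^ suc q
      last rewrite toℕ-fromℕ q | nCn≡1 (suc q) | ℕ.n∸n≡0 q =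
        trans (×-homo-1 _) (*-identityʳ _)

-- Powers and cancellation in commutative rings

module Powers (R : CommutativeRing ℓ₁ ℓ₂) where

  open CommutativeRing R hiding (zero)
  open Exp semiring using (_^_; ^-congˡ; ^-congʳ; ^-assocʳ; ^-homo-*)
  open import Relation.Binary.Reasoning.Setoid setoid

  swap-exponents : ∀ x m n → (x ^ m) ^ n ≈ (x ^ n) ^ m
  swap-exponents x m n = begin
    (x ^ m) ^ n   ≈⟨ ^-assocʳ x m n ⟩
    x ^ (m ℕ.* n) ≈⟨ ^-congʳ x (ℕ.*-comm m n) ⟩
    x ^ (n ℕ.* m) ≈⟨ ^-assocʳ x n m ⟨
    (x ^ n) ^ m   ∎

  power-cong : ∀ {x y} n m → x ^ m ≈ y ^ m → (x ^ n) ^ m ≈ (y ^ n) ^ m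
  power-cong {x} {y} n m p =
    trans (swap-exponents x n m) (trans (^-congˡ n p) (swap-exponents y m n))

  1^n≈1 : ∀ n → 1# ^ n ≈ 1#
  1^n≈1 zero    = refl
  1^n≈1 (suc n) = trans (*-identityˡ _) (1^n≈1 n)

  ^-periodic : ∀ {x m} r q → x ^ m ≈ 1# → x ^ (r ℕ.+ q ℕ.* m) ≈ x ^ r
  ^-periodic {x} {m} r q xᵐ≈1 = begin
    x ^ (r ℕ.+ q ℕ.* m)   ≈⟨ ^-homo-* x r (q ℕ.* m) ⟩
    x ^ r * x ^ (q ℕ.* m) ≈⟨ *-congˡ (^-congʳ x (ℕ.*-comm q m)) ⟩
    x ^ r * x ^ (m ℕ.* q) ≈⟨ *-congˡ (^-assocʳ x m q) ⟨
    x ^ r * (x ^ m) ^ q   ≈⟨ *-congˡ (trans (^-congˡ q xᵐ≈1) (1^n≈1 q)) ⟩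
    x ^ r * 1#            ≈⟨ *-identityʳ _ ⟩
    x ^ r                 ∎

module Identities (R : CommutativeRing ℓ₁ ℓ₂) where

  open CommutativeRing R hiding (zero)
  open SemiringSolver commutativeSemiring
  open Exp semiring using (_^_)

  -- The third cyclotomic polynomial made homogeneous: a condition on the quotient x/y that needs no
  -- division.
  Φ₃ : Op₂ Carrier
  Φ₃ x y = x * x + x * y + y * y

  Φ₃-cong : ∀ {x y u v} → x ≈ u → y ≈ v → Φ₃ x y ≈ Φ₃ u v
  Φ₃-cong p q = +-cong (+-cong (*-cong p p) (*-cong p q)) (*-cong q q)

  Φ₃-homogeneous : ∀ w y → Φ₃ (w * y) y ≈ Φ₃ w 1# * (y * y)
  Φ₃-homogeneous = solve 2 (λ w y →
    w :* y :* (w :* y) :+ w :* y :* y :+ y :* y :=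
    (w :* w :+ w :* con 1 :+ con 1 :* con 1) :* (y :* y)) refl

  Φ₃-xx : ∀ x → Φ₃ x x ≈ x * x * (1# + 1# + 1#)
  Φ₃-xx = solve 1 (λ x →
    x :* x :+ x :* x :+ x :* x := x :* x :* (con 1 :+ con 1 :+ con 1)) refl

  -- x³ - y³ = (x - y) Φ₃(x, y), without subtraction
  Φ₃-cubes : ∀ x y → x ^ 3 + Φ₃ x y * y ≈ y ^ 3 + Φ₃ x y * x
  Φ₃-cubes = solve 2 (λ x y →
    let Φ = x :* x :+ x :* y :+ y :* y
    in x :* (x :* (x :* con 1)) :+ Φ :* y := y :* (y :* (y :* con 1)) :+ Φ :* x) refl

  ^6-distrib : ∀ x y → let p = x * y in p * p * p * (p * p * p) ≈ x ^ 6 * y ^ 6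
  ^6-distrib = solve 2 (λ x y →
    let p = x :* y
    in p :* p :* p :* (p :* p :* p) :=
       x :* (x :* (x :* (x :* (x :* (x :* con 1))))) :*
       (y :* (y :* (y :* (y :* (y :* (y :* con 1))))))) refl

  -- For t = x² + y² and a = (xy)² this is t² - 2a = x⁴ + y⁴, the quadratic half of the recursion of
  -- S. The subtracted term stands on the right because the solver works in semirings.
  dickson₂ : ∀ x y → let p = x * y in
    (x * x + y * y) * (x * x + y * y) ≈ x * x * (x * x) + y * y * (y * y) + (p * p + p * p)
  dickson₂ = solve 2 (λ x y →
    let p = x :* y
    in (x :* x :+ y :* y) :* (x :* x :+ y :* y) :=
       x :* x :* (x :* x) :+ y :* y :* (y :* y) :+ (p :* p :+ p :* p)) refl

  -- The cubic half: for u = x⁴ + y⁴ and a = (xy)⁴ it is u³ - 3au = x¹² + y¹². Together the two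
  -- halves pass from the exponent 2 to the exponent 12.
  dickson₃ : ∀ x y →
    let p = x * y
        u = x * x * (x * x) + y * y * (y * y)
        w = u * (p * p * (p * p))
    in u * u * u ≈ x ^ 6 * x ^ 6 + y ^ 6 * y ^ 6 + (w + w + w)
  dickson₃ = solve 2 (λ x y →
    let p = x :* y
        u = x :* x :* (x :* x) :+ y :* y :* (y :* y)
        w = u :* (p :* p :* (p :* p))
        x⁶ = x :* (x :* (x :* (x :* (x :* (x :* con 1)))))
        y⁶ = y :* (y :* (y :* (y :* (y :* (y :* con 1)))))
    in u :* u :* u := x⁶ :* x⁶ :+ y⁶ :* y⁶ :+ (w :+ w :+ w)) refl

module Cancellation (R : CommutativeRing ℓ₁ ℓ₂) where

  open CommutativeRing R hiding (zero)
  open Exp semiring using (_^_; ^-congˡ; ^-congʳ; ^-assocʳ; ^-homo-*)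
  open Powers R using (swap-exponents; power-cong)
  open Identities R using (Φ₃; Φ₃-cong; Φ₃-xx; Φ₃-cubes)
  open import Relation.Binary.Reasoning.Setoid setoid

  -- Takes the place of "nonzero" in a domain: ℤ[ζ₆]/q has zero divisors when the prime q splits.
  Cancellable : Carrier → Set _
  Cancellable x = ∀ {y z} → x * y ≈ x * z → y ≈ z

  cancellable-1 : Cancellable 1#
  cancellable-1 p = trans (sym (*-identityˡ _)) (trans p (*-identityˡ _))

  cancellable-* : ∀ {x y} → Cancellable x → Cancellable y → Cancellable (x * y)
  cancellable-* cx cy p = cy (cx (trans (sym (*-assoc _ _ _)) (trans p (*-assoc _ _ _))))

  cancellable-^ : ∀ {x} n → Cancellable x → Cancellable (x ^ n)
  cancellable-^ zero    cx = cancellable-1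
  cancellable-^ (suc n) cx = cancellable-* cx (cancellable-^ n cx)

  cancellable-factor : ∀ {x y u} → x * y ≈ u → Cancellable u → Cancellable y
  cancellable-factor {x} {y} {u} xy≈u cu {v} {w} p = cu (begin
    u * v       ≈⟨ *-congʳ xy≈u ⟨
    x * y * v   ≈⟨ *-assoc x y v ⟩
    x * (y * v) ≈⟨ *-congˡ p ⟩
    x * (y * w) ≈⟨ *-assoc x y w ⟨
    x * y * w   ≈⟨ *-congʳ xy≈u ⟩
    u * w       ∎)

  cancellable-unit : ∀ {x y} → x * y ≈ 1# → Cancellable y
  cancellable-unit xy≈1 = cancellable-factor xy≈1 cancellable-1

  module _ (3≉0 : ¬ (1# + 1# + 1# ≈ 0#)) where

    -- x/y is a primitive cube root of unity.
    3∣exponent : ∀ {x y} m → Cancellable x → Φ₃ x y ≈ 0# → x ^ m ≈ y ^ m → 3 ℕ.∣ m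
    3∣exponent {x} {y} m cx root xᵐ≈yᵐ = from (m divMod 3)
      where
      x≉y : ¬ (x ≈ y)
      x≉y x≈y = 3≉0 (cancellable-* cx cx (begin
        x * x * (1# + 1# + 1#) ≈⟨ Φ₃-xx x ⟨
        Φ₃ x x                 ≈⟨ Φ₃-cong refl x≈y ⟩
        Φ₃ x y                 ≈⟨ root ⟩
        0#                     ≈⟨ zeroʳ _ ⟨
        x * x * 0#             ∎))

      x³≈y³ : x ^ 3 ≈ y ^ 3
      x³≈y³ = begin
        x ^ 3              ≈⟨ +-identityʳ _ ⟨
        x ^ 3 + 0#         ≈⟨ +-congˡ (trans (*-congʳ root) (zeroˡ y)) ⟨
        x ^ 3 + Φ₃ x y * y ≈⟨ Φ₃-cubes x y ⟩
        y ^ 3 + Φ₃ x y * x ≈⟨ +-congˡ (trans (*-congʳ root) (zeroˡ x)) ⟩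
        y ^ 3 + 0#         ≈⟨ +-identityʳ _ ⟩
        y ^ 3              ∎

      reduce : ∀ r q → x ^ (r ℕ.+ q ℕ.* 3) ≈ y ^ (r ℕ.+ q ℕ.* 3) → x ^ r ≈ y ^ r
      reduce r q p = cancellable-^ (q ℕ.* 3) cx (begin
        x ^ (q ℕ.* 3) * x ^ r ≈⟨ *-comm _ _ ⟩
        x ^ r * x ^ (q ℕ.* 3) ≈⟨ ^-homo-* x r (q ℕ.* 3) ⟨
        x ^ (r ℕ.+ q ℕ.* 3)   ≈⟨ p ⟩
        y ^ (r ℕ.+ q ℕ.* 3)   ≈⟨ ^-homo-* y r (q ℕ.* 3) ⟩
        y ^ r * y ^ (q ℕ.* 3) ≈⟨ *-comm _ _ ⟩
        y ^ (q ℕ.* 3) * y ^ r ≈⟨ *-congʳ (trans (cube y) (trans (^-congˡ q (sym x³≈y³)) (sym (cube x)))) ⟩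
        x ^ (q ℕ.* 3) * y ^ r ∎)
        where
        cube : ∀ z → z ^ (q ℕ.* 3) ≈ (z ^ 3) ^ q
        cube z = trans (^-congʳ z (ℕ.*-comm q 3)) (sym (^-assocʳ z 3 q))

      -- A remainder 1 gives x ≈ y at once. A remainder 2 gives x² ≈ y², and comparison with x³ ≈ y³
      -- again yields x ≈ y. Both contradict `x≉y`.
      from : DivMod m 3 → 3 ℕ.∣ m
      from (result q 0F eq) = divides q eq
      from (result q 1F ≡.refl) = contradiction (begin
        x      ≈⟨ *-identityʳ x ⟨
        x ^ 1  ≈⟨ reduce 1 q xᵐ≈yᵐ ⟩
        y ^ 1  ≈⟨ *-identityʳ y ⟩
        y      ∎) x≉y
      from (result q 2F ≡.refl) = contradiction (cancellable-^ 2 cx (begin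
        x ^ 2 * x ≈⟨ *-comm _ _ ⟩
        x ^ 3     ≈⟨ x³≈y³ ⟩
        y * y ^ 2 ≈⟨ *-comm _ _ ⟩
        y ^ 2 * y ≈⟨ *-congʳ (reduce 2 q xᵐ≈yᵐ) ⟨
        x ^ 2 * y ∎)) x≉y

    -- Induction on k. The case k, applied to x³ and y³, gives m = q · n with n = 3ᵏ⁺¹. The quotient
    -- of xⁿ by yⁿ is a primitive cube root of unity and its q-th power is 1, so 3 divides q as
    -- well.
    3^∣exponent : ∀ {x y} k m → Cancellable x → Φ₃ (x ^ (3 ℕ.^ k)) (y ^ (3 ℕ.^ k)) ≈ 0# →
      x ^ m ≈ y ^ m → 3 ℕ.^ suc k ℕ.∣ m
    3^∣exponent zero m cx root xᵐ≈yᵐ =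
      3∣exponent m cx (trans (sym (Φ₃-cong (*-identityʳ _) (*-identityʳ _))) root) xᵐ≈yᵐ
    3^∣exponent {x} {y} (suc k) m cx root xᵐ≈yᵐ
      with 3^∣exponent k m (cancellable-^ 3 cx)
             (trans (Φ₃-cong (^-assocʳ x 3 (3 ℕ.^ k)) (^-assocʳ y 3 (3 ℕ.^ k))) root)
             (power-cong 3 m xᵐ≈yᵐ)
    ... | divides q ≡.refl = ℕ.*-monoˡ-∣ n
      (3∣exponent q (cancellable-^ n cx) root (begin
        (x ^ n) ^ q   ≈⟨ swap-exponents x n q ⟩
        (x ^ q) ^ n   ≈⟨ ^-assocʳ x q n ⟩
        x ^ (q ℕ.* n) ≈⟨ xᵐ≈yᵐ ⟩
        y ^ (q ℕ.* n) ≈⟨ ^-assocʳ y q n ⟨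
        (y ^ q) ^ n   ≈⟨ swap-exponents y q n ⟩
        (y ^ n) ^ q   ∎))
      where
      n = 3 ℕ.^ suc k

-- Integers modulo p

infix 4 _≋_mod_

-- The equation is solved for x: matching it with `refl` eliminates x, and the congruence laws
-- become polynomial identities for the solver.
record _≋_mod_ (x y : ℤ) (p : ℕ) : Set where
  constructor congruent
  field
    quotient : ℤ
    equation : x ≡ y ℤ.+ quotient ℤ.* + p

module _ (p : ℕ) where

  private
    ≋-reflexive : ∀ {x y} → x ≡ y → x ≋ y mod p
    ≋-reflexive {x} ≡.refl = congruent 0ℤ (≡.sym (ℤ.+-identityʳ x))

    ≋-sym : ∀ {x y} → x ≋ y mod p → y ≋ x mod p
    ≋-sym {x} {y} (congruent q ≡.refl) = congruent (ℤ.- q) (eq y q (+ p))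
      where
      eq : ∀ y q m → y ≡ y ℤ.+ q ℤ.* m ℤ.+ ℤ.- q ℤ.* m
      eq = ℤ.solve-∀

    ≋-trans : ∀ {x y z} → x ≋ y mod p → y ≋ z mod p → x ≋ z mod p
    ≋-trans {z = z} (congruent q ≡.refl) (congruent q′ ≡.refl) =
      congruent (q′ ℤ.+ q) (eq z q q′ (+ p))
      where
      eq : ∀ z q q′ m → z ℤ.+ q′ ℤ.* m ℤ.+ q ℤ.* m ≡ z ℤ.+ (q′ ℤ.+ q) ℤ.* m
      eq = ℤ.solve-∀

    +-cong : ∀ {x y u v} → x ≋ y mod p → u ≋ v mod p → x ℤ.+ u ≋ y ℤ.+ v mod p
    +-cong {y = y} {v = v} (congruent q ≡.refl) (congruent q′ ≡.refl) =
      congruent (q ℤ.+ q′) (eq y v q q′ (+ p))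
      where
      eq : ∀ y v q q′ m → y ℤ.+ q ℤ.* m ℤ.+ (v ℤ.+ q′ ℤ.* m) ≡ y ℤ.+ v ℤ.+ (q ℤ.+ q′) ℤ.* m
      eq = ℤ.solve-∀

    *-cong : ∀ {x y u v} → x ≋ y mod p → u ≋ v mod p → x ℤ.* u ≋ y ℤ.* v mod p
    *-cong {y = y} {v = v} (congruent q ≡.refl) (congruent q′ ≡.refl) =
      congruent (y ℤ.* q′ ℤ.+ q ℤ.* v ℤ.+ q ℤ.* q′ ℤ.* + p) (eq y v q q′ (+ p))
      where
      eq : ∀ y v q q′ m → (y ℤ.+ q ℤ.* m) ℤ.* (v ℤ.+ q′ ℤ.* m) ≡
        y ℤ.* v ℤ.+ (y ℤ.* q′ ℤ.+ q ℤ.* v ℤ.+ q ℤ.* q′ ℤ.* m) ℤ.* m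
      eq = ℤ.solve-∀

    -‿cong : ∀ {x y} → x ≋ y mod p → ℤ.- x ≋ ℤ.- y mod p
    -‿cong {y = y} (congruent q ≡.refl) = congruent (ℤ.- q) (eq y q (+ p))
      where
      eq : ∀ y q m → ℤ.- (y ℤ.+ q ℤ.* m) ≡ ℤ.- y ℤ.+ ℤ.- q ℤ.* m
      eq = ℤ.solve-∀

    additiveGroup : AbelianGroup 0ℓ 0ℓ
    additiveGroup = record
      { _≈_ = λ x y → x ≋ y mod p
      ; isAbelianGroup = record
        { isGroup = record
          { isMonoid = record
            { isSemigroup = record
              { isMagma = record
                { isEquivalence = record
                  { refl = ≋-reflexive ≡.refl ; sym = ≋-sym ; trans = ≋-trans }
                ; ∙-cong = +-cong
                }
              ; assoc = λ x y z → ≋-reflexive (ℤ.+-assoc x y z)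
              }
            ; identity = (λ x → ≋-reflexive (ℤ.+-identityˡ x)) ,
                         (λ x → ≋-reflexive (ℤ.+-identityʳ x))
            }
          ; inverse = (λ x → ≋-reflexive (ℤ.+-inverseˡ x)) ,
                      (λ x → ≋-reflexive (ℤ.+-inverseʳ x))
          ; ⁻¹-cong = -‿cong
          }
        ; comm = λ x y → ≋-reflexive (ℤ.+-comm x y)
        }
      }

  ℤ/ : CommutativeRing 0ℓ 0ℓ
  ℤ/ = commutativeRing additiveGroup ℤ._*_ 1ℤ *-cong
    (λ x y z → ≋-reflexive (ℤ.*-assoc x y z))
    (λ x y → ≋-reflexive (ℤ.*-comm x y))
    (λ x → ≋-reflexive (ℤ.*-identityˡ x))
    (λ x y z → ≋-reflexive (ℤ.*-distribˡ-+ x y z))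

  ℤ/-annihilates : Annihilates p ℤ/
  ℤ/-annihilates x = congruent x
    (≡.trans (multiple p) (≡.trans (ℤ.*-comm (+ p) x) (≡.sym (ℤ.+-identityˡ _))))
    where
    open Mult (CommutativeRing.semiring ℤ/) renaming (_×_ to _·_)
    multiple : ∀ n → n · x ≡ + n ℤ.* x
    multiple zero    = ≡.sym (ℤ.*-zeroˡ x)
    multiple (suc n) = ≡.trans (≡.cong (λ y → x ℤ.+ y) (multiple n)) (≡.sym (ℤ.suc-* (+ n) x))

∣⇒≋0 : ∀ {m x} → + m ℤ.∣ x → x ≋ 0ℤ mod m
∣⇒≋0 (ℤ.divides q eq) = congruent q (≡.trans eq (≡.sym (ℤ.+-identityˡ _)))

≋0⇒∣ : ∀ {m} x → + x ≋ 0ℤ mod m → m ℕ.∣ x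
≋0⇒∣ x (congruent q eq) = ℤ.∣⇒∣ᵤ (ℤ.divides q (≡.trans eq (ℤ.+-identityˡ _)))

≋-∣ : ∀ {m n x y} → m ℕ.∣ n → x ≋ y mod n → x ≋ y mod m
≋-∣ {m} {y = y} (divides s ≡.refl) (congruent q ≡.refl) =
  congruent (q ℤ.* + s) (≡.cong (λ e → y ℤ.+ e)
    (≡.trans (≡.cong (q ℤ.*_) (ℤ.pos-* s m)) (≡.sym (ℤ.*-assoc q (+ s) (+ m)))))

module _ (m : ℕ) where

  Unit : ℤ → Set
  Unit x = ∃[ y ] x ℤ.* y ≋ 1ℤ mod m

  unit-* : ∀ x y → Unit x → Unit y → Unit (x ℤ.* y)
  unit-* x y (x′ , xx′≋1) (y′ , yy′≋1) =
    x′ ℤ.* y′ , trans (reflexive (interchange x y x′ y′)) (*-cong xx′≋1 yy′≋1)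
    where
    open CommutativeRing (ℤ/ m) using (trans; reflexive; *-cong)
    interchange : ∀ x y x′ y′ → x ℤ.* y ℤ.* (x′ ℤ.* y′) ≡ x ℤ.* x′ ℤ.* (y ℤ.* y′)
    interchange = ℤ.solve-∀

  unit⇒coprime : ∀ {x} → Unit x → Coprime ℤ.∣ x ∣ m
  unit⇒coprime {x} (y , congruent q eq) {i} (i∣x , i∣m) = ℕ.∣1⇒≡1 (ℤ.∣⇒∣ᵤ {+ i} {1ℤ}
    (ℤ.∣m+n∣n⇒∣m {+ i} {1ℤ} {q ℤ.* + m}
      (≡.subst (+ i ℤ.∣_) eq (ℤ.∣m⇒∣m*n y (ℤ.∣ᵤ⇒∣ {+ i} {x} i∣x)))
      (ℤ.∣n⇒∣m*n q (ℤ.∣ᵤ⇒∣ {+ i} {+ m} i∣m))))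

-- The sequence S

-- S k = num k / den k.  The recursion is that of S, whose polynomial is the composite of u² - 2
-- and u³ - 3u, with denominators cleared.
num den : ℕ → ℤ
num zero    = ℤ.- + 13
num (suc k) = u ℤ.* u ℤ.* u ℤ.- + 3 ℤ.* u ℤ.* (d² ℤ.* d²)
  where
  d² = den k ℤ.* den k
  u = num k ℤ.* num k ℤ.- + 2 ℤ.* d²
den zero    = + 7
den (suc k) = den k ℤ.* den k ℤ.* den k ℤ.* (den k ℤ.* den k ℤ.* den k)

unit-den : ∀ {m} → Unit m (+ 7) → ∀ k → Unit m (den k)
unit-den u zero        = u
unit-den {m} u (suc k) = unit-* m d³ d³ d³-unit d³-unit
  where
  d = den k
  d³ = d ℤ.* d ℤ.* d
  d³-unit : Unit m d³
  d³-unit = unit-* m (d ℤ.* d) d (unit-* m d d (unit-den u k) (unit-den u k)) (unit-den u k)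

-- The embedding of ℤ in ℚ

fromℤ-+ : ∀ a b → fromℤ (a ℤ.+ b) ≡ fromℤ a ℚ.+ fromℤ b
fromℤ-+ a b = ℚ.toℚᵘ-injective
  (ℚᵘ.≃-trans (ℚᵘ.*≡* (eq a b)) (ℚᵘ.≃-sym (ℚ.toℚᵘ-homo-+ (fromℤ a) (fromℤ b))))
  where
  eq : ∀ a b → (a ℤ.+ b) ℤ.* 1ℤ ≡ (a ℤ.* 1ℤ ℤ.+ b ℤ.* 1ℤ) ℤ.* 1ℤ
  eq = ℤ.solve-∀

fromℤ-* : ∀ a b → fromℤ (a ℤ.* b) ≡ fromℤ a ℚ.* fromℤ b
fromℤ-* a b = ℚ.toℚᵘ-injective (ℚᵘ.≃-sym (ℚ.toℚᵘ-homo-* (fromℤ a) (fromℤ b)))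

fromℤ-neg : ∀ a → fromℤ (ℤ.- a) ≡ ℚ.- fromℤ a
fromℤ-neg (+ zero)   = ≡.refl
fromℤ-neg (+ suc n)  = ≡.refl
fromℤ-neg ℤ.-[1+ n ] = ≡.refl

fromℤ-sub : ∀ a b → fromℤ (a ℤ.- b) ≡ fromℤ a ℚ.- fromℤ b
fromℤ-sub a b = ≡.trans (fromℤ-+ a (ℤ.- b)) (≡.cong (fromℤ a ℚ.+_) (fromℤ-neg b))

fromℤ-injective : ∀ {a b} → fromℤ a ≡ fromℤ b → a ≡ b
fromℤ-injective = ≡.cong ↥_

*-denominator : ∀ p → p ℚ.* fromℤ (↧ p) ≡ fromℤ (↥ p)
*-denominator p@record{} = ℚ.toℚᵘ-injective
  (ℚᵘ.≃-trans (ℚ.toℚᵘ-homo-* p (fromℤ (↧ p))) (ℚᵘ.*≡* (ℤ.*-assoc (↥ p) (↧ p) 1ℤ)))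

xy∙z≡xz∙y : ∀ x y z → x ℚ.* y ℚ.* z ≡ x ℚ.* z ℚ.* y
xy∙z≡xz∙y = solve 3 (λ x y z → x :* y :* z := x :* z :* y) ≡.refl
  where open +-*-Solver

-- Moves an equation of rationals to ℤ, where divisibility can be argued.
cross-multiply : ∀ p a b → p ℚ.* fromℤ a ≡ fromℤ b → ↥ p ℤ.* a ≡ b ℤ.* ↧ p
cross-multiply p a b eq = fromℤ-injective (begin
  fromℤ (↥ p ℤ.* a)             ≡⟨ fromℤ-* (↥ p) a ⟩
  fromℤ (↥ p) ℚ.* fromℤ a       ≡⟨ ≡.cong (ℚ._* fromℤ a) (*-denominator p) ⟨
  p ℚ.* fromℤ (↧ p) ℚ.* fromℤ a ≡⟨ xy∙z≡xz∙y p (fromℤ (↧ p)) (fromℤ a) ⟩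
  p ℚ.* fromℤ a ℚ.* fromℤ (↧ p) ≡⟨ ≡.cong (ℚ._* fromℤ (↧ p)) eq ⟩
  fromℤ b ℚ.* fromℤ (↧ p)       ≡⟨ fromℤ-* b (↧ p) ⟨
  fromℤ (b ℤ.* ↧ p)             ∎)
  where open ≡.≡-Reasoning

-- The congruence for S as a congruence of integers

S*den≡num : ∀ k → S k ℚ.* fromℤ (den k) ≡ fromℤ (num k)
-- Since π + π̄ = 1 and ππ̄ = 7, S₀ = (π² + π̄²) / ππ̄ = (1 - 14) / 7.
S*den≡num zero    = ≡.refl
S*den≡num (suc k) = ≡.sym (begin
  fromℤ (u ℤ.* u ℤ.* u ℤ.- + 3 ℤ.* u ℤ.* (d² ℤ.* d²))
    ≡⟨ fromℤ-sub (u ℤ.* u ℤ.* u) (+ 3 ℤ.* u ℤ.* (d² ℤ.* d²)) ⟩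
  fromℤ (u ℤ.* u ℤ.* u) ℚ.- fromℤ (+ 3 ℤ.* u ℤ.* (d² ℤ.* d²))
    ≡⟨ ≡.cong₂ ℚ._-_
         (*-hom (u ℤ.* u) u (*-hom u u u≡U u≡U) u≡U)
         (*-hom (+ 3 ℤ.* u) (d² ℤ.* d²) (*-hom (+ 3) u ≡.refl u≡U) (*-hom d² d² d²≡D² d²≡D²)) ⟩
  U ℚ.* U ℚ.* U ℚ.- fromℕ 3 ℚ.* U ℚ.* (D ℚ.* D ℚ.* (D ℚ.* D))
    ≡⟨ clear-denominators (S k) D ⟨
  S (suc k) ℚ.* (D ℚ.* D ℚ.* D ℚ.* (D ℚ.* D ℚ.* D))
    ≡⟨ ≡.cong (S (suc k) ℚ.*_) (*-hom d³ d³ d³≡D³ d³≡D³) ⟨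
  S (suc k) ℚ.* fromℤ (den (suc k)) ∎)
  where
  open ≡.≡-Reasoning
  d² d³ u : ℤ
  d² = den k ℤ.* den k
  d³ = den k ℤ.* den k ℤ.* den k
  u = num k ℤ.* num k ℤ.- + 2 ℤ.* d²
  D U : ℚ
  D = fromℤ (den k)
  U = (S k ℚ.* D) ℚ.* (S k ℚ.* D) ℚ.- fromℕ 2 ℚ.* (D ℚ.* D)

  *-hom : ∀ a b {x y} → fromℤ a ≡ x → fromℤ b ≡ y → fromℤ (a ℤ.* b) ≡ x ℚ.* y
  *-hom a b p q = ≡.trans (fromℤ-* a b) (≡.cong₂ ℚ._*_ p q)

  d²≡D² : fromℤ d² ≡ D ℚ.* D
  d²≡D² = fromℤ-* (den k) (den k)

  d³≡D³ : fromℤ d³ ≡ D ℚ.* D ℚ.* D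
  d³≡D³ = *-hom d² (den k) d²≡D² ≡.refl

  u≡U : fromℤ u ≡ U
  u≡U = ≡.trans (fromℤ-sub (num k ℤ.* num k) (+ 2 ℤ.* d²)) (≡.cong₂ ℚ._-_
    (*-hom (num k) (num k) (≡.sym (S*den≡num k)) (≡.sym (S*den≡num k)))
    (*-hom (+ 2) d² ≡.refl d²≡D²))

  -- With v = s² - 2 the recursion polynomial is v³ - 3v; multiplying by D⁶ turns v into U = D²v.
  clear-denominators : ∀ s D → let U = (s ℚ.* D) ℚ.* (s ℚ.* D) ℚ.- fromℕ 2 ℚ.* (D ℚ.* D) in
    (s ^ℚ 6 ℚ.- fromℕ 6 ℚ.* s ^ℚ 4 ℚ.+ fromℕ 9 ℚ.* s ^ℚ 2 ℚ.- fromℕ 2) ℚ.*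
      (D ℚ.* D ℚ.* D ℚ.* (D ℚ.* D ℚ.* D)) ≡
    U ℚ.* U ℚ.* U ℚ.- fromℕ 3 ℚ.* U ℚ.* (D ℚ.* D ℚ.* (D ℚ.* D))
  clear-denominators = solve 2 (λ s D →
    let s² = s :* (s :* con 1ℚ)
        s⁴ = s :* (s :* s²)
        s⁶ = s :* (s :* s⁴)
        U = (s :* D) :* (s :* D) :- con (fromℕ 2) :* (D :* D)
    in (s⁶ :- con (fromℕ 6) :* s⁴ :+ con (fromℕ 9) :* s² :- con (fromℕ 2)) :*
         (D :* D :* D :* (D :* D :* D)) :=
       U :* U :* U :- con (fromℕ 3) :* U :* (D :* D :* (D :* D))) ≡.refl
    where open +-*-Solver

[S+1]*den≡num+den : ∀ k →
  (S k ℚ.- ℚ.- 1ℚ) ℚ.* fromℤ (den k) ≡ fromℤ (num k ℤ.+ den k)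
[S+1]*den≡num+den k = begin
  (S k ℚ.- ℚ.- 1ℚ) ℚ.* fromℤ (den k)         ≡⟨ expand (S k) (fromℤ (den k)) ⟩
  S k ℚ.* fromℤ (den k) ℚ.+ fromℤ (den k)    ≡⟨ ≡.cong (ℚ._+ fromℤ (den k)) (S*den≡num k) ⟩
  fromℤ (num k) ℚ.+ fromℤ (den k)            ≡⟨ fromℤ-+ (num k) (den k) ⟨
  fromℤ (num k ℤ.+ den k)                    ∎
  where
  open ≡.≡-Reasoning
  open +-*-Solver
  expand : ∀ s x → (s ℚ.- ℚ.- 1ℚ) ℚ.* x ≡ s ℚ.* x ℚ.+ x
  expand = solve 2 (λ s x → (s :- con (ℚ.- 1ℚ)) :* x := s :* x :+ x) ≡.refl

-- Write c = a/b. Multiplying S + 1 = mc by b and by `den k` gives m · a · den = (num + den) · b,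
-- and b is prime to m, so m divides num + den.
S≈-1⇒num+den≋0 : ∀ {m} k → S k ≈ ℚ.- 1ℚ [mod m ] → num k ℤ.+ den k ≋ 0ℤ mod m
S≈-1⇒num+den≋0 {m} k (c , coprime , S+1≡mc) = ∣⇒≋0 (ℤ.∣ᵤ⇒∣ {+ m} {x}
  (coprime-divisor (Coprimality.sym coprime)
    (≡.subst (m ℕ.∣_) (≡.trans (ℤ.abs-* x (↧ c)) (ℕ.*-comm ℤ.∣ x ∣ (↧ₙ c)))
      (ℤ.∣⇒∣ᵤ {+ m} (≡.subst (+ m ℤ.∣_) cross
        (ℤ.∣n⇒∣m*n (↥ c) (ℤ.∣m⇒∣m*n (den k) ℤ.∣-refl)))))))
  where
  open ≡.≡-Reasoning
  x = num k ℤ.+ den k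
  D = fromℤ (den k)
  cross : ↥ c ℤ.* (+ m ℤ.* den k) ≡ x ℤ.* ↧ c
  cross = cross-multiply c (+ m ℤ.* den k) x (begin
    c ℚ.* fromℤ (+ m ℤ.* den k) ≡⟨ ≡.cong (c ℚ.*_) (fromℤ-* (+ m) (den k)) ⟩
    c ℚ.* (fromℕ m ℚ.* D)       ≡⟨ ℚ.*-assoc c (fromℕ m) D ⟨
    c ℚ.* fromℕ m ℚ.* D         ≡⟨ ≡.cong (ℚ._* D) (≡.trans (ℚ.*-comm c (fromℕ m)) (≡.sym S+1≡mc)) ⟩
    (S k ℚ.- ℚ.- 1ℚ) ℚ.* D      ≡⟨ [S+1]*den≡num+den k ⟩
    fromℤ x                     ∎)

-- The witness has to be c = (S + 1) / m. As c times `den k` is the integer q, the denominator of c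
-- divides `den k`, which is a unit modulo m.
num+den≋0⇒S≈-1 : ∀ {m} .{{_ : ℕ.NonZero m}} k → Unit m (den k) →
  num k ℤ.+ den k ≋ 0ℤ mod m → S k ≈ ℚ.- 1ℚ [mod m ]
num+den≋0⇒S≈-1 {m} k unit (congruent q x≡qm) = c , coprime , ≡.sym m*c≡S+1
  where
  open ≡.≡-Reasoning
  x = num k ℤ.+ den k
  D = fromℤ (den k)
  s+1 m⁻¹ c : ℚ
  s+1 = S k ℚ.- ℚ.- 1ℚ
  m⁻¹ = ℚ.1/ fromℕ m
  c = s+1 ℚ.* m⁻¹

  m*c≡S+1 : fromℕ m ℚ.* c ≡ s+1
  m*c≡S+1 = begin
    fromℕ m ℚ.* (s+1 ℚ.* m⁻¹) ≡⟨ ℚ.*-comm (fromℕ m) c ⟩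
    s+1 ℚ.* m⁻¹ ℚ.* fromℕ m   ≡⟨ ℚ.*-assoc s+1 m⁻¹ (fromℕ m) ⟩
    s+1 ℚ.* (m⁻¹ ℚ.* fromℕ m) ≡⟨ ≡.cong (s+1 ℚ.*_) (ℚ.*-inverseˡ (fromℕ m)) ⟩
    s+1 ℚ.* 1ℚ                ≡⟨ ℚ.*-identityʳ s+1 ⟩
    s+1                       ∎

  c*den≡q : c ℚ.* D ≡ fromℤ q
  c*den≡q = begin
    s+1 ℚ.* m⁻¹ ℚ.* D               ≡⟨ xy∙z≡xz∙y s+1 m⁻¹ D ⟩
    s+1 ℚ.* D ℚ.* m⁻¹               ≡⟨ ≡.cong (ℚ._* m⁻¹) ([S+1]*den≡num+den k) ⟩
    fromℤ x ℚ.* m⁻¹                 ≡⟨ ≡.cong (λ x → fromℤ x ℚ.* m⁻¹) (≡.trans x≡qm (ℤ.+-identityˡ _)) ⟩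
    fromℤ (q ℤ.* + m) ℚ.* m⁻¹       ≡⟨ ≡.cong (ℚ._* m⁻¹) (fromℤ-* q (+ m)) ⟩
    fromℤ q ℚ.* fromℕ m ℚ.* m⁻¹     ≡⟨ ℚ.*-assoc (fromℤ q) (fromℕ m) m⁻¹ ⟩
    fromℤ q ℚ.* (fromℕ m ℚ.* m⁻¹)   ≡⟨ ≡.cong (fromℤ q ℚ.*_) (ℚ.*-inverseʳ (fromℕ m)) ⟩
    fromℤ q ℚ.* 1ℚ                  ≡⟨ ℚ.*-identityʳ _ ⟩
    fromℤ q                         ∎

  denominator∣den : ↧ₙ c ℕ.∣ ℤ.∣ den k ∣
  denominator∣den = coprime-divisor {n = ℤ.∣ ↥ c ∣} (Coprimality.sym (lowest-terms c))
    (≡.subst (↧ₙ c ℕ.∣_) (ℤ.abs-* (↥ c) (den k))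
      (ℤ.∣⇒∣ᵤ {↧ c} (ℤ.divides q (cross-multiply c (den k) q c*den≡q))))
    where
    lowest-terms : ∀ p → Coprime ℤ.∣ ↥ p ∣ (↧ₙ p)
    lowest-terms (mkℚ _ _ coprime) = Coprimality.recompute coprime

  coprime : DenominatorPrimeTo m c
  coprime (i∣c , i∣m) = unit⇒coprime m {den k} unit (ℕ.∣-trans i∣c denominator∣den , i∣m)

-- ℤ[ζ₆] modulo p

-- The ring is opaque because the type checker would otherwise unfold its elements into pairs of
-- integers; the facts below that unfold it are computations with explicit elements.
module Eisenstein (p : ℕ) where

  private module Q = QuadraticExtension (ℤ/ p) 1ℤ -1ℤ

  opaque
    ring : CommutativeRing 0ℓ 0ℓ
    ring = Q.extension

  open CommutativeRing ring public hiding (ring; zero)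
  open Exp semiring public using (_^_; ^-congˡ; ^-congʳ; ^-assocʳ; ^-homo-*)
  open CommutativeExp commutativeSemiring public using (^-distrib-*)
  open Powers ring public
  open Identities ring public
  open Cancellation ring public
  open RingProperties (CommutativeRing.ring ring) using (+-cancelʳ)
  open import Relation.Binary.Reasoning.Setoid setoid

  private
    -- The polynomial 2 + 3x², whose value at ζ₆ is π. Its coefficients are sums of ones, hence
    -- fixed by Frobenius, so Frobenius commutes with `ρ` and its effect on π and π̄ can be read off
    -- from that on ζ₆.
    ρ : Carrier → Carrier
    ρ x = 1# + 1# + (1# + 1# + 1#) * (x * x)

  opaque
    unfolding ring

    ι : ℤ → Carrier
    ι = Q.ι

    ι-+ : ∀ x y → ι (x ℤ.+ y) ≈ ι x + ι y
    ι-+ = Q.ι-+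

    ι-* : ∀ x y → ι (x ℤ.* y) ≈ ι x * ι y
    ι-* = Q.ι-*

    ι-injective : ∀ {x y} → ι x ≈ ι y → x ≋ y mod p
    ι-injective = proj₁

    ι-cong : ∀ {x y} → x ≋ y mod p → ι x ≈ ι y
    ι-cong x≋y = x≋y , CommutativeRing.refl (ℤ/ p)

    ι-0 : ι 0ℤ ≈ 0#
    ι-0 = reflexive ≡.refl

    ι-1 : ι 1ℤ ≈ 1#
    ι-1 = reflexive ≡.refl

    ι-3 : ι (+ 3) ≈ 1# + 1# + 1#
    ι-3 = reflexive ≡.refl

    annihilates : Annihilates p ring
    annihilates = Q.annihilates {p} (ℤ/-annihilates p)

    z π π̄ : Carrier
    z = 0ℤ , 1ℤ
    -- This is 2 + 3ζ₃ with ζ₃ = ζ₆ - 1; the conjugate below replaces ζ₆ by 1 - ζ₆.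
    π = -1ℤ , + 3
    π̄ = + 2 , ℤ.- + 3

    z⁶≈1 : z ^ 6 ≈ 1#
    z⁶≈1 = reflexive ≡.refl

    Φ₃[z⁴]≈0 : Φ₃ (z ^ 4) 1# ≈ 0#
    Φ₃[z⁴]≈0 = reflexive ≡.refl

    π≈ρ[z] : π ≈ ρ (z ^ 1)
    π≈ρ[z] = reflexive ≡.refl

    π̄≈ρ[z⁵] : π̄ ≈ ρ (z ^ 5)
    π̄≈ρ[z⁵] = reflexive ≡.refl

    -- Conjugation is z ↦ z⁵, so conjugating twice produces the exponent 25; `π̄^p≈π` needs π in
    -- this form.
    π≈ρ[z²⁵] : π ≈ ρ (z ^ 25)
    π≈ρ[z²⁵] = reflexive ≡.refl

    ππ̄≈7 : π * π̄ ≈ ι (+ 7)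
    ππ̄≈7 = reflexive ≡.refl

    ι-num₀ : ι (num 0) ≈ π ^ 1 * π ^ 1 + π̄ ^ 1 * π̄ ^ 1
    ι-num₀ = reflexive ≡.refl

    ι-den₀ : ι (den 0) ≈ π ^ 1 * π̄ ^ 1
    ι-den₀ = reflexive ≡.refl

  7-cancellable : Unit p (+ 7) → Cancellable (ι (+ 7))
  7-cancellable (v , 7v≋1) = cancellable-unit {ι v} (begin
    ι v * ι (+ 7) ≈⟨ *-comm _ _ ⟩
    ι (+ 7) * ι v ≈⟨ ι-* (+ 7) v ⟨
    ι (+ 7 ℤ.* v) ≈⟨ ι-cong 7v≋1 ⟩
    ι 1ℤ          ≈⟨ ι-1 ⟩
    1#            ∎)

  π-cancellable : Unit p (+ 7) → Cancellable π
  π-cancellable u = cancellable-factor (trans (*-comm π̄ π) ππ̄≈7) (7-cancellable u)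

  π̄-cancellable : Unit p (+ 7) → Cancellable π̄
  π̄-cancellable u = cancellable-factor ππ̄≈7 (7-cancellable u)

  private
    X Y : ℕ → Carrier
    X k = π ^ (6 ℕ.^ k)
    Y k = π̄ ^ (6 ℕ.^ k)

    sixth-power : ∀ x k → x ^ (6 ℕ.^ suc k) ≈ (x ^ (6 ℕ.^ k)) ^ 6
    sixth-power x k =
      trans (^-congʳ x (ℕ.*-comm 6 (6 ℕ.^ k))) (sym (^-assocʳ x (6 ℕ.^ k) 6))

  ι-den : ∀ k → ι (den k) ≈ X k * Y k
  ι-den zero    = ι-den₀
  ι-den (suc k) = begin
    ι (d³ ℤ.* d³)                ≈⟨ ι-* d³ d³ ⟩
    ι d³ * ι d³                  ≈⟨ *-cong ι-d³ ι-d³ ⟩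
    xy * xy * xy * (xy * xy * xy) ≈⟨ ^6-distrib (X k) (Y k) ⟩
    X k ^ 6 * Y k ^ 6            ≈⟨ *-cong (sixth-power π k) (sixth-power π̄ k) ⟨
    X (suc k) * Y (suc k)        ∎
    where
    d = den k
    d³ = d ℤ.* d ℤ.* d
    xy = X k * Y k
    ι-d³ : ι d³ ≈ xy * xy * xy
    ι-d³ = trans (ι-* (d ℤ.* d) d)
      (*-cong (trans (ι-* d d) (*-cong (ι-den k) (ι-den k))) (ι-den k))

  -- With K = 6ᵏ this is αᴷ + ᾱᴷ multiplied by (ππ̄)ᴷ. One step of the recursion replaces K by 6K
  -- through `dickson₂` and `dickson₃`; what these add on the right is added on the left too and
  -- then cancelled.
  ι-num : ∀ k → ι (num k) ≈ X k * X k + Y k * Y k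
  ι-num zero    = ι-num₀
  ι-num (suc k) = trans
    (+-cancelʳ (W + W + W) _ _ (begin
      ι (num (suc k)) + (W + W + W)               ≈⟨ +-congˡ (+-cong (+-cong ι-w ι-w) ι-w) ⟨
      ι (num (suc k)) + (ι w + ι w + ι w)         ≈⟨ +-congˡ (trans (ι-+ (w ℤ.+ w) w) (+-congʳ (ι-+ w w))) ⟨
      ι (num (suc k)) + ι (w ℤ.+ w ℤ.+ w)         ≈⟨ ι-+ (num (suc k)) (w ℤ.+ w ℤ.+ w) ⟨
      ι (num (suc k) ℤ.+ (w ℤ.+ w ℤ.+ w))         ≡⟨ ≡.cong ι (cubic u (d² ℤ.* d²)) ⟩
      ι (u ℤ.* u ℤ.* u)                           ≈⟨ trans (ι-* (u ℤ.* u) u) (*-congʳ (ι-* u u)) ⟩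
      ι u * ι u * ι u                             ≈⟨ *-cong (*-cong ι-u ι-u) ι-u ⟩
      U * U * U                                   ≈⟨ dickson₃ x y ⟩
      x ^ 6 * x ^ 6 + y ^ 6 * y ^ 6 + (W + W + W) ∎))
    (sym (+-cong (*-cong (sixth-power π k) (sixth-power π k))
                 (*-cong (sixth-power π̄ k) (sixth-power π̄ k))))
    where
    d² u w : ℤ
    d² = den k ℤ.* den k
    u = num k ℤ.* num k ℤ.- + 2 ℤ.* d²
    w = u ℤ.* (d² ℤ.* d²)
    x = X k
    y = Y k
    xy = x * y
    U W : Carrier
    U = x * x * (x * x) + y * y * (y * y)
    W = U * (xy * xy * (xy * xy))

    quadratic : ∀ a b → a ℤ.- + 2 ℤ.* b ℤ.+ (b ℤ.+ b) ≡ a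
    quadratic = ℤ.solve-∀

    cubic : ∀ u e → u ℤ.* u ℤ.* u ℤ.- + 3 ℤ.* u ℤ.* e ℤ.+ (u ℤ.* e ℤ.+ u ℤ.* e ℤ.+ u ℤ.* e) ≡
      u ℤ.* u ℤ.* u
    cubic = ℤ.solve-∀

    ι-d² : ι d² ≈ xy * xy
    ι-d² = trans (ι-* (den k) (den k)) (*-cong (ι-den k) (ι-den k))

    ι-u : ι u ≈ U
    ι-u = +-cancelʳ (xy * xy + xy * xy) _ _ (begin
      ι u + (xy * xy + xy * xy)         ≈⟨ +-congˡ (+-cong ι-d² ι-d²) ⟨
      ι u + (ι d² + ι d²)               ≈⟨ +-congˡ (ι-+ d² d²) ⟨
      ι u + ι (d² ℤ.+ d²)               ≈⟨ ι-+ u (d² ℤ.+ d²) ⟨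
      ι (u ℤ.+ (d² ℤ.+ d²))             ≡⟨ ≡.cong ι (quadratic (num k ℤ.* num k) d²) ⟩
      ι (num k ℤ.* num k)               ≈⟨ ι-* (num k) (num k) ⟩
      ι (num k) * ι (num k)             ≈⟨ *-cong (ι-num k) (ι-num k) ⟩
      (x * x + y * y) * (x * x + y * y) ≈⟨ dickson₂ x y ⟩
      U + (xy * xy + xy * xy)           ∎)

    ι-w : ι w ≈ W
    ι-w = trans (ι-* u (d² ℤ.* d²)) (*-cong ι-u (trans (ι-* d² d²) (*-cong ι-d² ι-d²)))

  -- The bridge used in both directions: as S = num / den, it makes S ≡ -1 the vanishing of `Φ₃` at
  -- X and Y.
  ι-num+den : ∀ k → ι (num k ℤ.+ den k) ≈ Φ₃ (X k) (Y k)
  ι-num+den k = begin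
    ι (num k ℤ.+ den k)                   ≈⟨ ι-+ (num k) (den k) ⟩
    ι (num k) + ι (den k)                 ≈⟨ +-cong (ι-num k) (ι-den k) ⟩
    X k * X k + Y k * Y k + X k * Y k     ≈⟨ +-assoc _ _ _ ⟩
    X k * X k + (Y k * Y k + X k * Y k)   ≈⟨ +-congˡ (+-comm _ _) ⟩
    X k * X k + (X k * Y k + Y k * Y k)   ≈⟨ +-assoc _ _ _ ⟨
    X k * X k + X k * Y k + Y k * Y k     ∎

  module _ (p-prime : Prime p) where

    open Frobenius ring p-prime annihilates

    private
      ρ-cong : ∀ {x y} → x ≈ y → ρ x ≈ ρ y
      ρ-cong e = +-congˡ (*-congˡ (*-cong e e))

      ρ-^p : ∀ x → ρ x ^ p ≈ ρ (x ^ p)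
      ρ-^p x = trans (^p-+ (1# + 1#) _)
        (+-cong 2^p≈2 (trans (^-distrib-* (1# + 1# + 1#) (x * x) p)
          (*-cong (trans (^p-+ (1# + 1#) 1#) (+-cong 2^p≈2 (1^n≈1 p))) (^-distrib-* x x p))))
        where
        2^p≈2 : (1# + 1#) ^ p ≈ 1# + 1#
        2^p≈2 = trans (^p-+ 1# 1#) (+-cong (1^n≈1 p) (1^n≈1 p))

      -- Frobenius acts on powers of z by multiplying exponents by r. Taking r = 1 gives the
      -- identity on π and π̄, and r = 5 gives complex conjugation.
      ρ[zⁿ]^p : ∀ n r → z ^ p ≈ z ^ r → ρ (z ^ n) ^ p ≈ ρ (z ^ (r ℕ.* n))
      ρ[zⁿ]^p n r zᵖ≈zʳ = begin
        ρ (z ^ n) ^ p     ≈⟨ ρ-^p (z ^ n) ⟩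
        ρ ((z ^ n) ^ p)   ≈⟨ ρ-cong (swap-exponents z n p) ⟩
        ρ ((z ^ p) ^ n)   ≈⟨ ρ-cong (^-congˡ n zᵖ≈zʳ) ⟩
        ρ ((z ^ r) ^ n)   ≈⟨ ρ-cong (^-assocʳ z r n) ⟩
        ρ (z ^ (r ℕ.* n)) ∎

    π^p≈π : z ^ p ≈ z ^ 1 → π ^ p ≈ π
    π^p≈π e = trans (^-congˡ p π≈ρ[z]) (trans (ρ[zⁿ]^p 1 1 e) (sym π≈ρ[z]))

    π̄^p≈π̄ : z ^ p ≈ z ^ 1 → π̄ ^ p ≈ π̄
    π̄^p≈π̄ e = trans (^-congˡ p π̄≈ρ[z⁵]) (trans (ρ[zⁿ]^p 5 1 e) (sym π̄≈ρ[z⁵]))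

    π^p≈π̄ : z ^ p ≈ z ^ 5 → π ^ p ≈ π̄
    π^p≈π̄ e = trans (^-congˡ p π≈ρ[z]) (trans (ρ[zⁿ]^p 1 5 e) (sym π̄≈ρ[z⁵]))

    π̄^p≈π : z ^ p ≈ z ^ 5 → π̄ ^ p ≈ π
    π̄^p≈π e = trans (^-congˡ p π̄≈ρ[z⁵]) (trans (ρ[zⁿ]^p 5 5 e) (sym π≈ρ[z²⁵]))

-- The sextic Gauss sum

-- ℤ[ζ₄₂]/p as a tower over ℤ[ζ₆]/p: η = ζ + ζ⁻¹ satisfies η³ = -η² + 2η + 1, and ζ² = ηζ - 1.
module Cyclotomic (p : ℕ) where

  private
    module A = Eisenstein p
    module Cubic = CubicExtension A.ring (A.ι -1ℤ) (A.ι (+ 2)) (A.ι 1ℤ)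
    module B = CommutativeRing Cubic.extension
    module Quadratic = QuadraticExtension Cubic.extension (A.0# , A.1# , A.0#) (B.- B.1#)

  opaque
    ring : CommutativeRing 0ℓ 0ℓ
    ring = Quadratic.extension

  open CommutativeRing ring hiding (ring; zero)
  open Exp semiring using (_^_; ^-congˡ; ^-congʳ; ^-assocʳ; ^-homo-*)
  open CommutativeExp commutativeSemiring using (^-distrib-*)
  open Powers ring
  open import Relation.Binary.Reasoning.Setoid setoid

  opaque
    unfolding ring

    ι : A.Carrier → Carrier
    ι x = Quadratic.ι (Cubic.ι x)

    ι-* : ∀ x y → ι (x A.* y) ≈ ι x * ι y
    ι-* x y = trans (Cubic.ι-* x y , B.refl) (Quadratic.ι-* (Cubic.ι x) (Cubic.ι y))

    ι-1 : ι A.1# ≈ 1#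
    ι-1 = refl

    ι-injective : ∀ {x y} → ι x ≈ ι y → x A.≈ y
    ι-injective ((e , _) , _) = e

    ι-cong : ∀ {x y} → x A.≈ y → ι x ≈ ι y
    ι-cong e = (e , A.refl , A.refl) , B.refl

    annihilates : Annihilates p ring
    annihilates = Quadratic.annihilates {p} (Cubic.annihilates {p} A.annihilates)

    ζ : Carrier
    ζ = B.0# , B.1#

  private
    Z : Carrier
    Z = ι A.z

  -- The character is the one that sends the primitive root 3 to ζ₆; y is a seventh root of unity.
  gaussSum : Carrier → Carrier
  gaussSum y = y ^ 1 + (Z ^ 1 * y ^ 3 + (Z ^ 2 * y ^ 2 +
    (Z ^ 3 * y ^ 6 + (Z ^ 4 * y ^ 4 + Z ^ 5 * y ^ 5))))

  gaussSum⁶ : A.Carrier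
  gaussSum⁶ = A.ι -1ℤ A.* (A.π A.* A.π̄ A.^ 5)

  opaque
    unfolding ι ζ A.z

    ζ⁷≈1 : ζ ^ 7 ≈ 1#
    ζ⁷≈1 = reflexive ≡.refl

    -- Evaluation of integer coordinates: the identity holds in ℤ[ζ₄₂] before any reduction, so p
    -- can stay arbitrary.
    gaussSum[ζ]⁶ : gaussSum ζ ^ 6 ≈ ι gaussSum⁶
    gaussSum[ζ]⁶ = reflexive ≡.refl

    -- Replacing ζ by ζ² multiplies the sum by the inverse of the character value at 2. As 2 ≡ 3²
    -- (mod 7), that value is ζ₆², with inverse ζ₆⁴.
    gaussSum[ζ²] : gaussSum (ζ ^ 2) ≈ ι (A.z A.^ 4) * gaussSum ζ
    gaussSum[ζ²] = reflexive ≡.refl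

  ι-^ : ∀ x n → ι (x A.^ n) ≈ ι x ^ n
  ι-^ x zero    = ι-1
  ι-^ x (suc n) = trans (ι-* x (x A.^ n)) (*-congˡ (ι-^ x n))

  module _ (p-prime : Prime p) where

    open Frobenius ring p-prime annihilates

    -- Frobenius acts term by term: it fixes the character values, which are powers of z, and sends
    -- ζ to ζ².
    gaussSum[ζ]^p : A.z A.^ p A.≈ A.z A.^ 1 → ζ ^ p ≈ ζ ^ 2 →
      gaussSum ζ ^ p ≈ ι (A.z A.^ 4) * gaussSum ζ
    gaussSum[ζ]^p zᵖ≈z ζᵖ≈ζ² = begin
      gaussSum ζ ^ p
        ≈⟨ trans (^p-+ _ _) (+-congˡ (trans (^p-+ _ _) (+-congˡ (trans (^p-+ _ _) (+-congˡ
             (trans (^p-+ _ _) (+-congˡ (^p-+ _ _)))))))) ⟩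
      (ζ ^ 1) ^ p + ((Z ^ 1 * ζ ^ 3) ^ p + ((Z ^ 2 * ζ ^ 2) ^ p +
        ((Z ^ 3 * ζ ^ 6) ^ p + ((Z ^ 4 * ζ ^ 4) ^ p + (Z ^ 5 * ζ ^ 5) ^ p))))
        ≈⟨ +-cong (trans (swap-exponents ζ 1 p) (^-congˡ 1 ζᵖ≈ζ²)) (+-cong (term 1 3)
             (+-cong (term 2 2) (+-cong (term 3 6) (+-cong (term 4 4) (term 5 5))))) ⟩
      gaussSum (ζ ^ 2)
        ≈⟨ gaussSum[ζ²] ⟩
      ι (A.z A.^ 4) * gaussSum ζ ∎
      where
      Zᵖ≈Z : Z ^ p ≈ Z
      Zᵖ≈Z = trans (sym (ι-^ A.z p)) (ι-cong (A.trans zᵖ≈z (A.*-identityʳ A.z)))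

      term : ∀ i j → (Z ^ i * ζ ^ j) ^ p ≈ Z ^ i * (ζ ^ 2) ^ j
      term i j = begin
        (Z ^ i * ζ ^ j) ^ p       ≈⟨ ^-distrib-* (Z ^ i) (ζ ^ j) p ⟩
        (Z ^ i) ^ p * (ζ ^ j) ^ p ≈⟨ *-cong (swap-exponents Z i p) (swap-exponents ζ j p) ⟩
        (Z ^ p) ^ i * (ζ ^ p) ^ j ≈⟨ *-cong (^-congˡ i Zᵖ≈Z) (^-congˡ j ζᵖ≈ζ²) ⟩
        Z ^ i * (ζ ^ 2) ^ j       ∎

    -- Both sides are g⁵gᵖ for g = gaussSum ζ; multiplying by g⁵ makes them lie in ℤ[ζ₆]/p.
    gaussSum⁶^ : ∀ K j → p ≡ 1 ℕ.+ K ℕ.* 6 → p ≡ 2 ℕ.+ j ℕ.* 7 →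
      gaussSum⁶ A.* gaussSum⁶ A.^ K A.≈ gaussSum⁶ A.* A.z A.^ 4
    gaussSum⁶^ K j p≡1+6K p≡2+7j = ι-injective (begin
      ι (c A.* c A.^ K)             ≈⟨ trans (ι-* c (c A.^ K)) (*-congˡ (ι-^ c K)) ⟩
      ι c * ι c ^ K                 ≈⟨ *-cong gaussSum[ζ]⁶ (^-congˡ K gaussSum[ζ]⁶) ⟨
      g ^ 6 * (g ^ 6) ^ K           ≈⟨ *-congˡ (trans (^-assocʳ g 6 K) (^-congʳ g (ℕ.*-comm 6 K))) ⟩
      g ^ 6 * g ^ (K ℕ.* 6)         ≈⟨ ^-homo-* g 6 (K ℕ.* 6) ⟨
      g ^ (5 ℕ.+ (1 ℕ.+ K ℕ.* 6))   ≡⟨ ≡.cong (λ n → g ^ (5 ℕ.+ n)) p≡1+6K ⟨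
      g ^ (5 ℕ.+ p)                 ≈⟨ ^-homo-* g 5 p ⟩
      g ^ 5 * g ^ p                 ≈⟨ *-congˡ (gaussSum[ζ]^p zᵖ≈z ζᵖ≈ζ²) ⟩
      g ^ 5 * (ι w * g)             ≈⟨ *-congˡ (*-comm (ι w) g) ⟩
      g ^ 5 * (g * ι w)             ≈⟨ *-assoc (g ^ 5) g (ι w) ⟨
      g ^ 5 * g * ι w               ≈⟨ *-congʳ (*-comm (g ^ 5) g) ⟩
      g ^ 6 * ι w                   ≈⟨ *-congʳ gaussSum[ζ]⁶ ⟩
      ι c * ι w                     ≈⟨ ι-* c w ⟨
      ι (c A.* w)                   ∎)
      where
      g = gaussSum ζ
      c = gaussSum⁶
      w = A.z A.^ 4

      zᵖ≈z : A.z A.^ p A.≈ A.z A.^ 1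
      zᵖ≈z = A.trans (A.^-congʳ A.z p≡1+6K) (A.^-periodic 1 K A.z⁶≈1)

      ζᵖ≈ζ² : ζ ^ p ≈ ζ ^ 2
      ζᵖ≈ζ² = trans (^-congʳ ζ p≡2+7j) (^-periodic 2 j ζ⁷≈1)

-- The congruence for a prime modulus

module _ {p : ℕ} (p-prime : Prime p) where

  open Eisenstein p
  open Cyclotomic p using (gaussSum⁶; gaussSum⁶^)
  open import Relation.Binary.Reasoning.Setoid setoid

  prime⇒Φ₃≈0 : ∀ K h j → K ≡ h ℕ.* 2 → p ≡ 1 ℕ.+ K ℕ.* 6 → p ≡ 2 ℕ.+ j ℕ.* 7 →
    Unit p (+ 7) → Φ₃ (π ^ K) (π̄ ^ K) ≈ 0#
  prime⇒Φ₃≈0 K h j K≡2h p≡1+6K p≡2+7j 7-unit = begin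
    Φ₃ X Y            ≈⟨ Φ₃-cong X≈wY refl ⟩
    Φ₃ (w * Y) Y      ≈⟨ Φ₃-homogeneous w Y ⟩
    Φ₃ w 1# * (Y * Y) ≈⟨ *-congʳ Φ₃[z⁴]≈0 ⟩
    0# * (Y * Y)      ≈⟨ zeroˡ _ ⟩
    0#                ∎
    where
    X = π ^ K
    Y = π̄ ^ K
    w = z ^ 4
    u = ι -1ℤ

    u²≈1 : u * u ≈ 1#
    u²≈1 = trans (sym (ι-* -1ℤ -1ℤ)) ι-1

    -- K is even, so the sign in -ππ̄⁵ disappears from its K-th power.
    uᴷ≈1 : u ^ K ≈ 1#
    uᴷ≈1 = trans (^-congʳ u K≡2h) (^-periodic 0 h (trans (*-congˡ (*-identityʳ u)) u²≈1))

    gaussSum⁶-cancellable : Cancellable gaussSum⁶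
    gaussSum⁶-cancellable = cancellable-* (cancellable-unit u²≈1)
      (cancellable-* (π-cancellable 7-unit) (cancellable-^ 5 (π̄-cancellable 7-unit)))

    -- As p ≡ 1 (mod 6), Frobenius fixes π̄. Hence Y⁵ is inverse to Y, and X Y⁵ below is the
    -- quotient X/Y.
    Y⁶≈1 : Y ^ 6 ≈ 1#
    Y⁶≈1 = π̄-cancellable 7-unit (begin
      π̄ * Y ^ 6           ≈⟨ *-congˡ (^-assocʳ π̄ K 6) ⟩
      π̄ ^ (1 ℕ.+ K ℕ.* 6) ≡⟨ ≡.cong (π̄ ^_) p≡1+6K ⟨
      π̄ ^ p               ≈⟨ π̄^p≈π̄ p-prime (trans (^-congʳ z p≡1+6K) (^-periodic 1 K z⁶≈1)) ⟩
      π̄                   ≈⟨ *-identityʳ π̄ ⟨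
      π̄ * 1#              ∎)

    XY⁵≈w : X * Y ^ 5 ≈ w
    XY⁵≈w = begin
      X * Y ^ 5               ≈⟨ *-congˡ (swap-exponents π̄ K 5) ⟩
      X * (π̄ ^ 5) ^ K         ≈⟨ ^-distrib-* π (π̄ ^ 5) K ⟨
      (π * π̄ ^ 5) ^ K         ≈⟨ *-identityˡ _ ⟨
      1# * (π * π̄ ^ 5) ^ K    ≈⟨ *-congʳ uᴷ≈1 ⟨
      u ^ K * (π * π̄ ^ 5) ^ K ≈⟨ ^-distrib-* u (π * π̄ ^ 5) K ⟨
      gaussSum⁶ ^ K           ≈⟨ gaussSum⁶-cancellable (gaussSum⁶^ p-prime K j p≡1+6K p≡2+7j) ⟩
      w                       ∎

    X≈wY : X ≈ w * Y
    X≈wY = begin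
      X               ≈⟨ *-identityʳ X ⟨
      X * 1#          ≈⟨ *-congˡ Y⁶≈1 ⟨
      X * (Y * Y ^ 5) ≈⟨ *-congˡ (*-comm Y (Y ^ 5)) ⟩
      X * (Y ^ 5 * Y) ≈⟨ *-assoc X (Y ^ 5) Y ⟨
      X * Y ^ 5 * Y   ≈⟨ *-congʳ XY⁵≈w ⟩
      w * Y           ∎

-- Prime divisors of 6ʳ + 1

^-distribʳ-* : ∀ m n k → (m ℕ.* n) ℕ.^ k ≡ m ℕ.^ k ℕ.* n ℕ.^ k
^-distribʳ-* m n zero    = ≡.refl
^-distribʳ-* m n (suc k) = ≡.trans (≡.cong (m ℕ.* n ℕ.*_) (^-distribʳ-* m n k))
  (ℕ.[m*n]*[o*p]≡[m*o]*[n*p] m n (m ℕ.^ k) (n ℕ.^ k))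

module PrimeDivisor {q : ℕ} (q-prime : Prime q) (k : ℕ) (q∣M : q ℕ.∣ 6 ℕ.^ suc k ℕ.+ 1)
  (7-unit : Unit q (+ 7)) where

  open Eisenstein q

  -- The number 6ʳ + 1 is 1 modulo each divisor of 6. This rules out q = 2 and q = 3.
  ∣6∧∣q⇒≡1 : ∀ {n} → n ℕ.∣ 6 → n ℕ.∣ q → n ≡ 1
  ∣6∧∣q⇒≡1 n∣6 n∣q = ℕ.∣1⇒≡1
    (ℕ.∣m+n∣m⇒∣n (ℕ.∣-trans n∣q q∣M) (ℕ.∣-trans n∣6 (ℕ.m∣m*n (6 ℕ.^ k))))

  3≉0 : ¬ (1# + 1# + 1# ≈ 0#)
  3≉0 3≈0 = contradiction (≡.subst Prime (∣6∧∣q⇒≡1 q∣6 ℕ.∣-refl) q-prime) ¬prime[1]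
    where
    q∣6 : q ℕ.∣ 6
    q∣6 = ℕ.∣-trans (≋0⇒∣ 3 (ι-injective (trans ι-3 (trans 3≈0 (sym ι-0))))) (divides 2 ≡.refl)

  module _ (root : Φ₃ (π ^ (6 ℕ.^ k)) (π̄ ^ (6 ℕ.^ k)) ≈ 0#) where

    -- As 6ᵏ = 2ᵏ · 3ᵏ, the 2ᵏ-th powers of π and π̄ have a quotient whose 3ᵏ-th power is a
    -- primitive cube root of unity.
    3ʳ∣exponent : ∀ m → π ^ m ≈ π̄ ^ m → 3 ℕ.^ suc k ℕ.∣ m
    3ʳ∣exponent m πᵐ≈π̄ᵐ = 3^∣exponent 3≉0 k m (cancellable-^ (2 ℕ.^ k) (π-cancellable 7-unit))
      (trans (Φ₃-cong (split π) (split π̄)) root) (power-cong (2 ℕ.^ k) m πᵐ≈π̄ᵐ)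
      where
      split : ∀ x → (x ^ (2 ℕ.^ k)) ^ (3 ℕ.^ k) ≈ x ^ (6 ℕ.^ k)
      split x = trans (^-assocʳ x (2 ℕ.^ k) (3 ℕ.^ k)) (^-congʳ x (≡.sym (^-distribʳ-* 2 3 k)))

    -- Modulo 6 only 1 and 5 are possible for q. In the first case Frobenius fixes π and π̄, and the
    -- exponent q - 1 makes both powers 1. In the second it swaps them, and the exponent q + 1 makes
    -- both powers ππ̄.
    3ʳ≤1+q : 3 ℕ.^ suc k ℕ.≤ suc q
    3ʳ≤1+q = from (q divMod 6)
      where
      2∤q : ¬ (2 ℕ.∣ q)
      2∤q 2∣q with () ← ∣6∧∣q⇒≡1 (divides 3 ≡.refl) 2∣q

      3∤q : ¬ (3 ℕ.∣ q)
      3∤q 3∣q with () ← ∣6∧∣q⇒≡1 (divides 2 ≡.refl) 3∣q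

      even : ∀ i j → q ≡ i ℕ.* 2 ℕ.+ j ℕ.* 6 → 2 ℕ.∣ q
      even i j eq = ≡.subst (2 ℕ.∣_) (≡.sym eq)
        (ℕ.∣m∣n⇒∣m+n (divides i ≡.refl) (ℕ.∣n⇒∣m*n j (divides 3 ≡.refl)))

      z^q : ∀ r j → q ≡ r ℕ.+ j ℕ.* 6 → z ^ q ≈ z ^ r
      z^q r j eq = trans (^-congʳ z eq) (^-periodic r j z⁶≈1)

      fixed⇒≈1 : ∀ {x} n → Cancellable x → q ≡ suc n → x ^ q ≈ x → x ^ n ≈ 1#
      fixed⇒≈1 {x} n cx eq e =
        cx (trans (^-congʳ x (≡.sym eq)) (trans e (sym (*-identityʳ x))))

      from : DivMod q 6 → 3 ℕ.^ suc k ℕ.≤ suc q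
      from (result j 0F eq) = contradiction (even 0 j eq) 2∤q
      -- The value q = 1 is split off so that the exponent q - 1 is positive and bounds its
      -- divisors.
      from (result zero 1F eq) = contradiction (≡.subst Prime eq q-prime) ¬prime[1]
      from (result (suc j) 1F eq) = ℕ.≤-trans (ℕ.∣⇒≤ (3ʳ∣exponent n πⁿ≈π̄ⁿ))
        (ℕ.≤-trans (ℕ.n≤1+n n) (ℕ.≤-trans (ℕ.≤-reflexive (≡.sym eq)) (ℕ.n≤1+n q)))
        where
        n = suc j ℕ.* 6
        πⁿ≈π̄ⁿ : π ^ n ≈ π̄ ^ n
        πⁿ≈π̄ⁿ = trans
          (fixed⇒≈1 n (π-cancellable 7-unit) eq (π^p≈π q-prime (z^q 1 (suc j) eq)))
          (sym (fixed⇒≈1 n (π̄-cancellable 7-unit) eq (π̄^p≈π̄ q-prime (z^q 1 (suc j) eq))))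
      from (result j 2F eq) = contradiction (even 1 j eq) 2∤q
      from (result j 3F eq) = contradiction (≡.subst (3 ℕ.∣_) (≡.sym eq)
        (ℕ.∣m∣n⇒∣m+n (divides 1 ≡.refl) (ℕ.∣n⇒∣m*n j (divides 2 ≡.refl)))) 3∤q
      from (result j 4F eq) = contradiction (even 2 j eq) 2∤q
      from (result j 5F eq) = ℕ.∣⇒≤ (3ʳ∣exponent (suc q) (trans
        (*-congˡ (π^p≈π̄ q-prime (z^q 5 j eq)))
        (trans (*-comm π π̄) (sym (*-congˡ (π̄^p≈π q-prime (z^q 5 j eq)))))))

-- Roughness is raised one number at a time: if m is (2 + j)-rough and 2 + j divides it, then 2 + j
-- is prime and the bound applies to it.
prime-divisors-bounded⇒rough : ∀ {m} b → (∀ {q} → Prime q → q ℕ.∣ m → b ℕ.≤ q) → b Rough m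
prime-divisors-bounded⇒rough 0 _ = 0-rough
prime-divisors-bounded⇒rough 1 _ = 1-rough
prime-divisors-bounded⇒rough {m} (suc (suc b)) bounded = go b ℕ.≤-refl
  where
  go : ∀ j → j ℕ.≤ b → (2 ℕ.+ j) Rough m
  go zero    _   = 2-rough
  go (suc j) j<b = ∤⇒rough-suc
    (λ j∣m → ℕ.<⇒≱ (s≤s (s≤s j<b)) (bounded (rough∧∣⇒prime rough j∣m) j∣m)) rough
    where rough = go j (ℕ.<⇒≤ j<b)

-- Supplies 2ʳ + 2 ≤ 3ʳ - 1 for the comparison of 6ʳ + 1 with (3ʳ - 1)². The inequality is false at
-- r = 1, so the induction starts at r = 2 with 6 < 9.
2+2^[2+k]<3^[2+k] : ∀ k → 2 ℕ.+ 2 ℕ.^ (2 ℕ.+ k) ℕ.< 3 ℕ.^ (2 ℕ.+ k)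
2+2^[2+k]<3^[2+k] zero    = ℕ.m≤m+n 7 2
2+2^[2+k]<3^[2+k] (suc k) = begin-strict
  2 ℕ.+ 2 ℕ.* a               ≤⟨ ℕ.m≤m+n _ (a ℕ.+ 4) ⟩
  2 ℕ.+ 2 ℕ.* a ℕ.+ (a ℕ.+ 4) ≡⟨ expand a ⟩
  3 ℕ.* (2 ℕ.+ a)             <⟨ ℕ.*-monoʳ-< 3 (2+2^[2+k]<3^[2+k] k) ⟩
  3 ℕ.* 3 ℕ.^ (2 ℕ.+ k)       ∎
  where
  open ℕ.≤-Reasoning
  a = 2 ℕ.^ (2 ℕ.+ k)
  expand : ∀ a → 2 ℕ.+ 2 ℕ.* a ℕ.+ (a ℕ.+ 4) ≡ 3 ℕ.* (2 ℕ.+ a)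
  expand = ℕ.solve-∀

-- With a = 2ʳ and m = 3ʳ - 1 the left-hand side is 6ʳ + 1.
a[1+m]+1<m² : ∀ {a m} → 2 ℕ.+ a ℕ.≤ m → a ℕ.* suc m ℕ.+ 1 ℕ.< m ℕ.* m
a[1+m]+1<m² {a} 2+a≤m with ℕ.m≤n⇒∃[o]m+o≡n 2+a≤m
... | e , ≡.refl = begin-strict
  a ℕ.* (3 ℕ.+ a ℕ.+ e) ℕ.+ 1
    -- With m = 2 + a + e, the implicit argument is the difference of the two sides, visibly
    -- positive.
    <⟨ ℕ.m<m+n _ {3 ℕ.+ a ℕ.+ e ℕ.* e ℕ.+ a ℕ.* e ℕ.+ 4 ℕ.* e} (s≤s z≤n) ⟩
  a ℕ.* (3 ℕ.+ a ℕ.+ e) ℕ.+ 1 ℕ.+ (3 ℕ.+ a ℕ.+ e ℕ.* e ℕ.+ a ℕ.* e ℕ.+ 4 ℕ.* e)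
    ≡⟨ expand a e ⟩
  (2 ℕ.+ a ℕ.+ e) ℕ.* (2 ℕ.+ a ℕ.+ e) ∎
  where
  open ℕ.≤-Reasoning
  expand : ∀ a e →
    a ℕ.* (3 ℕ.+ a ℕ.+ e) ℕ.+ 1 ℕ.+ (3 ℕ.+ a ℕ.+ e ℕ.* e ℕ.+ a ℕ.* e ℕ.+ 4 ℕ.* e) ≡
    (2 ℕ.+ a ℕ.+ e) ℕ.* (2 ℕ.+ a ℕ.+ e)
  expand = ℕ.solve-∀

-- The criterion

open import Data.Nat using (_+_; _^_; _∸_; _≥_)
open import Data.Rational using (-_)

-- Since 36 = 1 + 5 · 7, even powers of 6 are 1 modulo 7, which places M at 2 modulo 7.
36^e≡1+7i : ∀ e → ∃[ i ] 36 ^ e ≡ 1 + i ℕ.* 7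
36^e≡1+7i zero = 0 , ≡.refl
36^e≡1+7i (suc e) with i , eq ← 36^e≡1+7i e =
  5 + 36 ℕ.* i , ≡.trans (≡.cong (36 ℕ.*_) eq) (expand i)
  where
  expand : ∀ i → 36 ℕ.* (1 + i ℕ.* 7) ≡ 1 + (5 + 36 ℕ.* i) ℕ.* 7
  expand = ℕ.solve-∀

-- Here r = 2e + 2 and k = r - 1. Evenness of r gives M ≡ 2 (mod 7), while r ≥ 2 makes K = 6ᵏ even
-- and starts the inequality between 2ʳ and 3ʳ.
criterion : ∀ e → let k = suc (2 ℕ.* e) ; M = 6 ^ suc k + 1 in Prime M ⇔ (S k ≈ - 1ℚ [mod M ])
criterion e = mk⇔
  (λ M-prime → num+den≋0⇒S≈-1 k (unit-den 7-unit k) (prime⇒num+den≋0 M-prime))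
  (λ S≈-1 → num+den≋0⇒prime (S≈-1⇒num+den≋0 k S≈-1))
  where
  k = suc (2 ℕ.* e)
  M = 6 ^ suc k + 1
  i = proj₁ (36^e≡1+7i e)
  -- The quotient of M by 7: M = 36 (1 + 7i) + 1 = 2 + 7 (5 + 36i).
  j = 5 + 36 ℕ.* i

  instance
    M-nonTrivial : ℕ.NonTrivial M
    M-nonTrivial = ℕ.n>1⇒nonTrivial (ℕ.+-monoˡ-≤ 1 (ℕ.m^n>0 6 (suc k)))
    M-nonZero : ℕ.NonZero M
    M-nonZero = ℕ.nonTrivial⇒nonZero M

  6^k≡6*36^e : 6 ^ k ≡ 6 ℕ.* 36 ^ e
  6^k≡6*36^e = ≡.cong (6 ℕ.*_) (≡.sym (ℕ.^-*-assoc 6 2 e))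

  6^k≡2h : 6 ^ k ≡ 3 ℕ.* 36 ^ e ℕ.* 2
  6^k≡2h = ≡.trans 6^k≡6*36^e (halve (36 ^ e))
    where
    halve : ∀ x → 6 ℕ.* x ≡ 3 ℕ.* x ℕ.* 2
    halve = ℕ.solve-∀

  M≡1+6K : M ≡ 1 + 6 ^ k ℕ.* 6
  M≡1+6K = ≡.trans (ℕ.+-comm (6 ^ suc k) 1) (≡.cong suc (ℕ.*-comm 6 (6 ^ k)))

  M≡2+7j : M ≡ 2 + j ℕ.* 7
  M≡2+7j = ≡.trans
    (≡.cong (λ x → 6 ℕ.* x + 1) (≡.trans 6^k≡6*36^e (≡.cong (6 ℕ.*_) (proj₂ (36^e≡1+7i e)))))
    (expand i)
    where
    expand : ∀ i → 6 ℕ.* (6 ℕ.* (1 + i ℕ.* 7)) + 1 ≡ 2 + (5 + 36 ℕ.* i) ℕ.* 7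
    expand = ℕ.solve-∀

  7-unit : Unit M (+ 7)
  -- From M = 2 + 7j follows 7 (1 + 3j) = 1 + 3M.
  7-unit = + (1 + 3 ℕ.* j) , congruent (+ 3)
    (≡.trans (≡.cong +_ 7v≡1+3M) (≡.cong (λ x → 1ℤ ℤ.+ x) (ℤ.pos-* 3 M)))
    where
    expand : ∀ j → 7 ℕ.* (1 + 3 ℕ.* j) ≡ 1 + 3 ℕ.* (2 + j ℕ.* 7)
    expand = ℕ.solve-∀
    7v≡1+3M : 7 ℕ.* (1 + 3 ℕ.* j) ≡ 1 + 3 ℕ.* M
    7v≡1+3M = ≡.trans (expand j) (≡.cong (λ m → 1 + 3 ℕ.* m) (≡.sym M≡2+7j))

  prime⇒num+den≋0 : Prime M → num k ℤ.+ den k ≋ 0ℤ mod M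
  prime⇒num+den≋0 M-prime = ι-injective (trans (ι-num+den k) (trans
    (prime⇒Φ₃≈0 M-prime (6 ^ k) (3 ℕ.* 36 ^ e) j 6^k≡2h M≡1+6K M≡2+7j 7-unit) (sym ι-0)))
    where open Eisenstein M using (trans; sym; ι-injective; ι-num+den; ι-0)

  num+den≋0⇒prime : num k ℤ.+ den k ≋ 0ℤ mod M → Prime M
  num+den≋0⇒prime num+den≋0 = rough∧square>⇒prime
    (prime-divisors-bounded⇒rough b
      (λ {q} q-prime q∣M → ℕ.s≤s⁻¹ (≡.subst (ℕ._≤ suc q) (≡.sym 1+b≡3ʳ) (bound q-prime q∣M))))
    (≡.subst (λ x → x + 1 ℕ.< b ℕ.* b)
      (≡.trans (≡.cong (2 ^ suc k ℕ.*_) 1+b≡3ʳ) (≡.sym (^-distribʳ-* 2 3 (suc k))))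
      (a[1+m]+1<m² (ℕ.s≤s⁻¹
        (≡.subst (2 + 2 ^ suc k ℕ.<_) (≡.sym 1+b≡3ʳ) (2+2^[2+k]<3^[2+k] (2 ℕ.* e))))))
    where
    -- Every prime divisor q of M satisfies 3ʳ ≤ q + 1, that is b ≤ q, and M < b².
    b = ℕ.pred (3 ^ suc k)
    1+b≡3ʳ : suc b ≡ 3 ^ suc k
    1+b≡3ʳ = ℕ.suc-pred (3 ^ suc k) {{ℕ.m^n≢0 3 (suc k)}}

    bound : ∀ {q} → Prime q → q ℕ.∣ M → 3 ^ suc k ℕ.≤ suc q
    bound {q} q-prime q∣M = PrimeDivisor.3ʳ≤1+q q-prime k q∣M
      (proj₁ 7-unit , ≋-∣ q∣M (proj₂ 7-unit))
      (trans (sym (ι-num+den k)) (trans (ι-cong (≋-∣ q∣M num+den≋0)) ι-0))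
      where open Eisenstein q using (trans; sym; ι-num+den; ι-cong; ι-0)

proposition4p1 : (n : ℕ) → n ≥ 1 →
    let r = 2 ^ n
        M = 6 ^ (2 ^ n) + 1
    in Prime M ⇔ (S (r ∸ 1) ≈ - 1ℚ [mod M ])
proposition4p1 (suc n) _ =
  ≡.subst (λ r → Prime (6 ^ r + 1) ⇔ (S (r ∸ 1) ≈ - 1ℚ [mod 6 ^ r + 1 ])) 2+2e≡2^[1+n] (criterion e)
  where
  -- Chosen so that 2ⁿ⁺¹ = 2 (e + 1), the shape of r in `criterion`.
  e = ℕ.pred (2 ^ n)
  2+2e≡2^[1+n] : suc (suc (2 ℕ.* e)) ≡ 2 ^ suc n
  2+2e≡2^[1+n] = ≡.trans (double e) (≡.cong (2 ℕ.*_) (ℕ.suc-pred (2 ^ n) {{ℕ.m^n≢0 2 n}}))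
    where
    double : ∀ e → suc (suc (2 ℕ.* e)) ≡ 2 ℕ.* suc e
    double = ℕ.solve-∀
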